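{- Let $n\ge 3$. The dual graph $D(\mathcal{T}_n^{\mathrm{LRL}})$ is a subgraph of the $(n-2)$-dimensional square grid graph via the embedding $\Delta\mapsto\mathbf{x}(\Delta)$. That is, the map $\Delta\mapsto \mathbf{x}(\Delta)$ from $\mathcal{T}_n^{\mathrm{LRL}}$ to $\mathbb{Z}^{n-2}$ is injective, and whenever two simplices $\Delta,\Delta'\in\mathcal{T}_n^{\mathrm{LRL}}$ are adjacent, $\mathbf{x}(\Delta)$ and $\mathbf{x}(\Delta')$ are adjacent in the square grid graph.
   Context: The contracted zigzag graph $G_n$ (written $\widehat{\mathrm{Zig}}_n$) is the directed multigraph with vertices $1,\dots,n$ and edges $x_i=(i,i+1)$ for $1\le i\le n-1$ (slack edges), $y_0=(1,2)$, $y_i=(i,i+2)$ for $1\le i\le n-2$, and $y_{n-1}=(n-1,n)$ (nonslack edges). The inner vertices are $2,\dots,n-1$. Each inner vertex $i$ has incoming edges $\{x_{i-1},y_{i-2}\}$ and outgoing edges $\{x_i,y_i\}$. The length-reverse-length (LRL) framing orders them by $y_{i-2}\prec x_{i-1}$ (incoming) and $x_i\prec y_i$ (outgoing) at every inner vertex $i$. A route is a directed path from $1$ to $n$; a prefix at $i$ is a directed path from $1$ to $i$; a suffix at $i$ is a directed path from $i$ to $n$. Paths are sequences of edges (parallel edges are distinguished). For distinct prefixes $P,P'$ at an inner vertex $i$, let $j\le i$ be the vertex after which they coincide and which they enter along different edges $e$ (of $P$) and $e'$ (of $P'$); set $P\prec P'$ if $e\prec e'$ in the incoming order at $j$. For distinct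 suffixes $Q,Q'$ at $i$, let $k\ge i$ be the first vertex which they leave along different edges $e$ (of $Q$), $e'$ (of $Q'$); set $Q\prec Q'$ if $e\prec e'$ in the outgoing order at $k$. Two routes $R=PiQ$ and $R'=P'iQ'$ through a common inner vertex $i$ (with prefixes $P,P'$ and suffixes $Q,Q'$ at $i$) conflict at $i$ if the prefixes and suffixes are oppositely ordered ($P\prec P'$ and $Q'\prec Q$, or vice versa). A maximal clique is an inclusion-maximal set of routes no two of which conflict at any vertex. Each route is identified with its 0/1 indicator vector in $\mathbb{R}^{E(G_n)}$, a vertex of the flow polytope of nonnegative unit flows from $1$ to $n$. For a maximal clique $C$, $\Delta_C$ is the convex hull of its routes; the $\Delta_C$ are the maximal simplices of a regular unimodular triangulation of this flow polytope (Danilov–Karzanov–Koshevoy). $\mathcal{T}_n^{\mathrm{LRL}}$ denotes the set of these simplices. Two simplices are adjacent if they share a codimension 1 face, equivalently if their maximal cliques differ by exactly one route. The dual graph $D(\mathcal{T}_n^{\mathrm{LRL}})$ has vertex set $\mathcal{T}_n^{\mathrm{LRL}}$ and an edge between each pair of adjacent simplices. $\mathcal{F}_n^{\mathbb{Z}}$ is the set of functions $\phi:E(G_n)\to\mathbb{Z}_{\ge0}$ with $\sum_{e\text{ into }i}\phi(e)+d_i=\sum_{e\text{ out of }i}\phi(e)$ for every vertex $i$, where $(d_1,\dots,d_n)=(0,1,1,\dots,1,-(n-2))$. There is a bijection (Mészáros–Morales–Striker) $\Delta_C\mapsto\phi(\Delta_C)$ from $\mathcal{T}_n^{\mathrm{LRL}}$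 to $\mathcal{F}_n^{\mathbb{Z}}$: $\phi(\Delta_C)(e)=0$ if $e$ leaves vertex $1$, and if $e$ leaves an inner vertex $i$, then $\phi(\Delta_C)(e)$ is one less than the number of prefixes $P$ at $i$ such that some route of $C$ begins with $P$ followed by $e$. Elementary moves on $\mathcal{F}_n^{\mathbb{Z}}$, for $2\le i\le n-1$: if $\phi(x_i)>0$ and $\phi(y_{i+1})>0$, then $m_i^+(\phi)$ is the flow obtained by subtracting one from $\phi(x_i)$ and $\phi(y_{i+1})$ and adding one to $\phi(x_{i+2})$ and $\phi(y_i)$; otherwise $m_i^+$ does not apply. If $\phi(x_{i+2})>0$ and $\phi(y_i)>0$, then $m_i^-(\phi)$ is the flow obtained by subtracting one from $\phi(x_{i+2})$ and $\phi(y_i)$ and adding one to $\phi(x_i)$ and $\phi(y_{i+1})$; otherwise $m_i^-$ does not apply. When $i\in\{n-2,n-1\}$, all conditions and operations involving the nonexistent values $\phi(x_n),\phi(y_n),\phi(x_{n+1})$ are ignored. Coordinate vector: let $\phi_0\in\mathcal{F}_n^{\mathbb{Z}}$ be the flow with $\phi_0(x_i)=i-1$ for $1\le i\le n-1$ and value $0$ on all nonslack edges. For each $\Delta\in\mathcal{T}_n^{\mathrm{LRL}}$ there is a (possibly empty) sequence of elementary moves $(m_{j_1}^{\epsilon_1},\dots,m_{j_l}^{\epsilon_l})$, $\epsilon_k\in\{+,-\}$, with $\phi(\Delta)=m_{j_l}^{\epsilon_l}\circ\cdots\circ m_{j_1}^{\epsilon_1}(\phi_0)$ (each move applicable). Define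 $\mathbf{x}(\Delta)=\sum_{k=1}^l\epsilon_k\mathbf{e}_{j_k}\in\mathbb{Z}^{n-2}$, where $\mathbf{e}_2,\dots,\mathbf{e}_{n-1}$ are the standard basis vectors of $\mathbb{Z}^{n-2}$ (coordinates indexed by $2,\dots,n-1$) and $\epsilon_k$ is read as $\pm1$; this vector does not depend on the choice of sequence. The $(n-2)$-dimensional square grid graph has vertex set $\mathbb{Z}^{n-2}$, two points being adjacent if and only if they differ by $\pm\mathbf{e}_k$ for some $k$. -}

module Defs where

open import Data.Bool.Base using (Bool; T; if_then_else_)
open import Data.Fin.Base using (Fin; toℕ; fromℕ<)
open import Data.Fin.Properties using (toℕ<n; toℕ-fromℕ<; toℕ-injective)
open import Data.Integer.Base as ℤ using (ℤ; +_; 0ℤ; 1ℤ; _◃_)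
open import Data.List.Base
  using (List; []; _∷_; _++_; map; concatMap; filter; filterᵇ; allFin; length)
open import Data.List.Membership.Propositional using (_∈_; find; lose)
open import Data.List.Membership.Propositional.Properties
  using (∈-map⁺; ∈-map⁻; ∈-++⁺ˡ; ∈-++⁺ʳ; ∈-allFin; ∈-concatMap⁺; ∈-concatMap⁻)
open import Data.List.Relation.Binary.Disjoint.Propositional using (Disjoint)
open import Data.List.Relation.Unary.All as All using ()
open import Data.List.Relation.Unary.All.Properties as Allₚ using ()
open import Data.List.Relation.Unary.AllPairs as AllPairs using ([]; _∷_)
open import Data.List.Relation.Unary.AllPairs.Properties as AllPairsₚ using ()
open import Data.List.Relation.Unary.Any using (here)
open import Data.List.Relation.Unary.Unique.Propositional using (Unique)
open import Data.List.Relation.Unary.Unique.Propositional.Properties as Uniqueₚ using ()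
open import Data.Bool.ListAction using (any)
open import Data.Nat.ListAction using (sum)
open import Data.Maybe.Base using (Maybe; just; nothing)
open import Data.Maybe.Properties using (just-injective)
open import Data.Nat.Base
  using (ℕ; zero; suc; _+_; _∸_; _⊔_; _⊓_; _≡ᵇ_; _≤_; _<_; z≤n; s≤s; s<s; s<s⁻¹)
open import Data.Nat.Properties
  using (_≟_; _<?_; suc-injective; n<1+n; n≤1+n; ≤-refl; ≤-trans; <-≤-trans; ≤⇒≯; ⊓-glb; m⊓n≤n; m≤m+n; +-suc; +-monoʳ-≤)
open import Data.Product.Base using (Σ-syntax; ∃-syntax; _×_; _,_)
open import Data.Sign.Base using (Sign)
open import Data.Sum.Base using (_⊎_)
open import Data.Vec.Base as Vec using (Vec; replicate; zipWith; _[_]≔_)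
open import Function.Base using (_∘_)
open import Relation.Binary.Construct.Closure.ReflexiveTransitive using (Star; ε; _◅_; _◅◅_)
open import Relation.Binary.PropositionalEquality
  using (_≡_; _≢_; _≗_; refl; sym; trans; cong; subst)
open import Relation.Nullary using (¬_; yes; no; recompute; contradiction)

-- The vertices of the graph are the natural numbers 1,…,n.
data Edge (n : ℕ) : Set where
  x : (i : ℕ) → .(1 ≤ i) → .(i < n) → Edge n
  y : (i : ℕ) → .(i < n) → Edge n

-- The maximum and minimum account for the two exceptional nonslack
-- edges: y₀ = (1,2) and yₙ₋₁ = (n-1,n).  For n ≥ 3 all others are
-- yᵢ = (i,i+2).
source target : ∀ {n} → Edge n → ℕ
source     (x i _ _) = i
source     (y i _)   = 1 ⊔ i
target     (x i _ _) = suc i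
target {n} (y i _)   = (2 + i) ⊓ n

Inner : ℕ → ℕ → Set
Inner n i = 2 ≤ i × i < n

slack : ∀ {m} → Fin m → Edge (suc m)
slack k = x (suc (toℕ k)) (s≤s z≤n) (s<s (toℕ<n k))

nonslack : ∀ {n} → Fin n → Edge n
nonslack k = y (toℕ k) (toℕ<n k)

edges : ∀ n → List (Edge n)
edges zero    = []
edges (suc m) = map slack (allFin m) ++ map nonslack (allFin (suc m))

edges-complete : ∀ {n} (e : Edge n) → e ∈ edges n
edges-complete {suc m} (x (suc i) p q) =
  ∈-++⁺ˡ (subst (_∈ map slack (allFin m)) (x-cong (toℕ-fromℕ< i<m))
    (∈-map⁺ slack (∈-allFin (fromℕ< i<m))))
  where
  i<m : i < m
  i<m = s<s⁻¹ (recompute (suc i <? suc m) q)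
  x-cong : ∀ {j k} .{p p′ q q′} → j ≡ k → x {suc m} (suc j) p q ≡ x (suc k) p′ q′
  x-cong refl = refl
edges-complete {suc m} (y i p) =
  ∈-++⁺ʳ (map slack (allFin m)) (subst (_∈ map nonslack (allFin (suc m)))
    (y-cong (toℕ-fromℕ< i<n)) (∈-map⁺ nonslack (∈-allFin (fromℕ< i<n))))
  where
  i<n : i < suc m
  i<n = recompute (i <? suc m) p
  y-cong : ∀ {j k} .{p p′} → j ≡ k → y {suc m} j p ≡ y k p′
  y-cong refl = refl

edges-unique : ∀ n → Unique (edges n)
edges-unique zero    = []
edges-unique (suc m) = Uniqueₚ.++⁺
  (Uniqueₚ.map⁺ (toℕ-injective ∘ suc-injective ∘ cong index) (Uniqueₚ.allFin⁺ m))
  (Uniqueₚ.map⁺ (toℕ-injective ∘ cong index) (Uniqueₚ.allFin⁺ (suc m)))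
  x≢y
  where
  index : Edge (suc m) → ℕ
  index (x i _ _) = i
  index (y i _)   = i
  x≢y : Disjoint (map slack (allFin m)) (map nonslack (allFin (suc m)))
  x≢y (e∈xs , e∈ys) with ∈-map⁻ slack e∈xs | ∈-map⁻ nonslack e∈ys
  ... | _ , _ , refl | _ , _ , ()

record Arc (n i j : ℕ) : Set where
  constructor arc
  field
    edge    : Edge n
    .starts : source edge ≡ i
    .ends   : target edge ≡ j

arrow : ∀ {n} (e : Edge n) → Arc n (source e) (target e)
arrow e = arc e refl refl

Path : ∀ n → ℕ → ℕ → Set
Path n = Star (Arc n)

Route : ℕ → Set
Route n = Path n 1 n

emptyPath : ∀ n i j → List (Path n i j)
emptyPath n i j with i ≟ j
... | yes refl = ε ∷ []
... | no  _    = []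

mutual
  pathsUpTo : ∀ n (maxLength : ℕ) i j → List (Path n i j)
  pathsUpTo n zero    i j = emptyPath n i j
  pathsUpTo n (suc l) i j = emptyPath n i j ++ concatMap (pathsFrom n l i j) (edges n)

  pathsFrom : ∀ n (maxLength : ℕ) i j → Edge n → List (Path n i j)
  pathsFrom n l i j e with source e ≟ i
  ... | yes p = map (arc e p refl ◅_) (pathsUpTo n l (target e) j)
  ... | no  _ = []

-- Every edge increases the vertex (for n ≥ 2), so a path has at most n edges.
paths : ∀ n i j → List (Path n i j)
paths n = pathsUpTo n n

source<target : ∀ {n} → 2 ≤ n → (e : Edge n) → source e < target e
source<target 2≤n (x i _ _)           = n<1+n i
source<target 2≤n (y zero _)          = ⊓-glb ≤-refl 2≤n
source<target {n} 2≤n (y (suc i) 1+i<n) =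
  ⊓-glb (n≤1+n _) (recompute (suc i <? n) 1+i<n)

target≤n : ∀ {n} (e : Edge n) → target e ≤ n
target≤n {n} (x i _ i<n) = recompute (i <? n) i<n
target≤n {n} (y i _)     = m⊓n≤n (2 + i) n

paths-complete : ∀ {n i j} → 2 ≤ n → (P : Path n i j) → P ∈ paths n i j
paths-complete {n} 2≤n = upTo n (m≤m+n n _)
  where
  ε∈ : ∀ i → ε ∈ emptyPath n i i
  ε∈ i with i ≟ i
  ... | yes refl = here refl
  ... | no  i≢i  = contradiction refl i≢i

  upTo : ∀ l {i j} → n ≤ l + i → (P : Path n i j) → P ∈ pathsUpTo n l i j
  from : ∀ l {i j k} → n ≤ suc l + i → (a : Arc n i k) (P : Path n k j) →
         (a ◅ P) ∈ pathsFrom n l i j (Arc.edge a)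

  upTo zero    {i} _ ε = ε∈ i
  upTo (suc l) {i} _ ε = ∈-++⁺ˡ (ε∈ i)
  upTo zero    {i} n≤i (arc e s _ ◅ _) = contradiction
    (<-≤-trans (source<target 2≤n e) (target≤n e))
    (≤⇒≯ (subst (n ≤_) (sym (recompute (_ ≟ _) s)) n≤i))
  upTo (suc l) {i} {j} n≤l+i (a ◅ P) = ∈-++⁺ʳ (emptyPath n i j)
    (∈-concatMap⁺ (pathsFrom n l i j) (lose (edges-complete (Arc.edge a)) (from l n≤l+i a P)))

  from l {i} n≤l+i (arc e s t) P with source e ≟ i | recompute (target e ≟ _) t
  ... | no  s≢i  | _    = contradiction (recompute (_ ≟ _) s) s≢i
  ... | yes refl | refl = ∈-map⁺ _ (upTo l
    (≤-trans n≤l+i (subst (_≤ l + target e) (+-suc l (source e))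
      (+-monoʳ-≤ l (source<target 2≤n e)))) P)

paths-unique : ∀ n i j → Unique (paths n i j)
paths-unique n = upTo n
  where
  firstEdge : ∀ {i j} → Path n i j → Maybe (Edge n)
  firstEdge ε       = nothing
  firstEdge (a ◅ _) = just (Arc.edge a)

  firstEdge-empty : ∀ {i j P} → P ∈ emptyPath n i j → firstEdge P ≡ nothing
  firstEdge-empty {i} {j} P∈ with i ≟ j
  firstEdge-empty (here refl) | yes refl = refl

  firstEdge-from : ∀ l {i j} e {P} → P ∈ pathsFrom n l i j e → firstEdge P ≡ just e
  firstEdge-from l {i} e P∈ with source e ≟ i
  ... | yes _ with ∈-map⁻ _ P∈
  ...   | _ , _ , refl = refl

  empty : ∀ i j → Unique (emptyPath n i j)
  empty i j with i ≟ j
  ... | yes refl = All.[] ∷ []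
  ... | no  _    = []

  ◅-injective : ∀ {i j k} {a : Arc n i j} {P Q : Path n j k} → a ◅ P ≡ a ◅ Q → P ≡ Q
  ◅-injective refl = refl

  upTo : ∀ l i j → Unique (pathsUpTo n l i j)
  from : ∀ l i j e → Unique (pathsFrom n l i j e)

  upTo zero    i j = empty i j
  upTo (suc l) i j = Uniqueₚ.++⁺ (empty i j)
    (Uniqueₚ.concat⁺
      (Allₚ.map⁺ (All.universal (from l i j) (edges n)))
      (AllPairsₚ.map⁺ (AllPairs.map separate (edges-unique n))))
    disjoint
    where
    separate : ∀ {e e′} → e ≢ e′ → Disjoint (pathsFrom n l i j e) (pathsFrom n l i j e′)
    separate e≢e′ (P∈ , P∈′) = e≢e′ (just-injective
      (trans (sym (firstEdge-from l _ P∈)) (firstEdge-from l _ P∈′)))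
    disjoint : Disjoint (emptyPath n i j) (concatMap (pathsFrom n l i j) (edges n))
    disjoint (P∈ , P∈′) with find (∈-concatMap⁻ (pathsFrom n l i j) {xs = edges n} P∈′)
    ... | e , _ , P∈e with trans (sym (firstEdge-empty P∈)) (firstEdge-from l e P∈e)
    ...   | ()

  from l i j e with source e ≟ i
  ... | yes _ = Uniqueₚ.map⁺ ◅-injective (upTo l (target e) j)
  ... | no  _ = []

-- The two edges entering i = k + 2.
data _≺ⁱⁿ_ {n} : Edge n → Edge n → Set where
  y≺x : ∀ {k} .{p q r} → y k p ≺ⁱⁿ x (suc k) q r

-- The two edges leaving i = k.
data _≺ᵒᵘᵗ_ {n} : Edge n → Edge n → Set where
  x≺y : ∀ {k} .{p q r} → x k p q ≺ᵒᵘᵗ y k r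

data _≺ᵖ_ {n i} : Path n 1 i → Path n 1 i → Set where
  diverge : ∀ {h h′ j} {a : Arc n h j} {a′ : Arc n h′ j} →
            Arc.edge a ≺ⁱⁿ Arc.edge a′ →
            (P : Path n 1 h) (P′ : Path n 1 h′) (common : Path n j i) →
            (P ◅◅ a ◅ common) ≺ᵖ (P′ ◅◅ a′ ◅ common)

data _≺ˢ_ {n i} : Path n i n → Path n i n → Set where
  diverge : ∀ {h h′ k} {a : Arc n k h} {a′ : Arc n k h′} →
            Arc.edge a ≺ᵒᵘᵗ Arc.edge a′ →
            (common : Path n i k) (Q : Path n h n) (Q′ : Path n h′ n) →
            (common ◅◅ a ◅ Q) ≺ˢ (common ◅◅ a′ ◅ Q′)

Conflict : ∀ {n} → Route n → Route n → Set
Conflict {n} R R′ =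
  ∃[ i ] Σ[ P ∈ Path n 1 i ] Σ[ P′ ∈ Path n 1 i ] Σ[ Q ∈ Path n i n ] Σ[ Q′ ∈ Path n i n ]
    Inner n i × R ≡ P ◅◅ Q × R′ ≡ P′ ◅◅ Q′ ×
    ((P ≺ᵖ P′ × Q′ ≺ˢ Q) ⊎ (P′ ≺ᵖ P × Q ≺ˢ Q′))

-- Sets of routes are finite, hence given by characteristic functions
-- and compared pointwise.
RouteSet : ℕ → Set
RouteSet n = Route n → Bool

infix 4 _∈ᴿ_ _∉ᴿ_

_∈ᴿ_ _∉ᴿ_ : ∀ {n} → Route n → RouteSet n → Set
R ∈ᴿ C = T (C R)
R ∉ᴿ C = ¬ R ∈ᴿ C

IsClique : ∀ {n} → RouteSet n → Set
IsClique C = ∀ R R′ → R ∈ᴿ C → R′ ∈ᴿ C → ¬ Conflict R R′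

-- A maximal clique stands for the simplex of the triangulation whose
-- vertices are the indicator vectors of its routes.
record MaximalClique (n : ℕ) : Set where
  field
    routes   : RouteSet n
    isClique : IsClique routes
    maximal  : ∀ D → IsClique D → (∀ R → R ∈ᴿ routes → R ∈ᴿ D) →
               ∀ R → R ∈ᴿ D → R ∈ᴿ routes

open MaximalClique public using (routes)

_≈_ : ∀ {n} → MaximalClique n → MaximalClique n → Set
C ≈ D = routes C ≗ routes D

-- The cliques differ by exactly one route: C ∖ {R} = D ∖ {S}.
Adjacent : ∀ {n} → MaximalClique n → MaximalClique n → Set
Adjacent {n} C D = Σ[ R ∈ Route n ] Σ[ S ∈ Route n ]
  R ∈ᴿ routes C × R ∉ᴿ routes D ×
  S ∈ᴿ routes D × S ∉ᴿ routes C ×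
  (∀ R′ → R′ ≢ R → R′ ≢ S → routes C R′ ≡ routes D R′)

Σ-into Σ-outOf : ∀ {n} → (Edge n → ℕ) → ℕ → ℕ
Σ-into  {n} f i = sum (map f (filter (λ e → target e ≟ i) (edges n)))
Σ-outOf {n} f i = sum (map f (filter (λ e → source e ≟ i) (edges n)))

netflow : ℕ → ℕ → ℤ
netflow n i = if i ≡ᵇ 1 then 0ℤ else if i ≡ᵇ n then ℤ.- + (n ∸ 2) else 1ℤ

record Flow (n : ℕ) : Set where
  field
    value     : Edge n → ℕ
    conserved : ∀ i → 1 ≤ i → i ≤ n →
                + Σ-into value i ℤ.+ netflow n i ≡ + Σ-outOf value i

open Flow public using (value)

φ₀ : ∀ {n} → Edge n → ℕ
φ₀ (x i _ _) = i ∸ 1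
φ₀ (y _ _)   = 0

-- The prefixes P at the source of e such that some route of C begins
-- with P followed by e.
prefixesBefore : ∀ {n} → MaximalClique n → (e : Edge n) → List (Path n 1 (source e))
prefixesBefore {n} C e = filterᵇ
  (λ P → any (λ Q → routes C (P ◅◅ arrow e ◅ Q)) (paths n (target e) n))
  (paths n 1 (source e))

φ : ∀ {n} → MaximalClique n → Edge n → ℤ
φ C e = if source e ≡ᵇ 1 then 0ℤ else + length (prefixesBefore C e) ℤ.- 1ℤ

δ : ℕ → ℕ → ℤ
δ i j = if i ≡ᵇ j then 1ℤ else 0ℤ

-- The change made by mᵢ⁺; mᵢ⁻ makes the opposite change.
change : ∀ {n} → ℕ → Edge n → ℤ
change i (x k _ _) = δ k (2 + i) ℤ.- δ k i
change i (y k _)   = δ k i ℤ.- δ k (suc i)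

-- Values on nonexistent edges are ignored: each positivity condition
-- is required only if the index of its edge is in range.
data Move {n} (i : ℕ) (f g : Flow n) : Sign → Set where
  m⁺ : (∀ .p .q → 0 < value f (x i p q)) →
       (∀ .p → 0 < value f (y (suc i) p)) →
       (∀ e → + value g e ≡ + value f e ℤ.+ change i e) →
       Move i f g Sign.+
  m⁻ : (∀ .p .q → 0 < value f (x (2 + i) p q)) →
       (∀ .p → 0 < value f (y i p)) →
       (∀ e → + value g e ≡ + value f e ℤ.- change i e) →
       Move i f g Sign.-

_⊞_ : ∀ {d} → Vec ℤ d → Vec ℤ d → Vec ℤ d
_⊞_ = zipWith ℤ._+_

0ᵛ : ∀ {d} → Vec ℤ d
0ᵛ = replicate _ 0ℤ

±e : ∀ {d} → Sign → Fin d → Vec ℤ d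
±e s k = 0ᵛ [ k ]≔ (s ◃ 1)

-- f ⟶⟨ v ⟩ g: a sequence of moves leads from f to g, and v is the sum of
-- the corresponding signed basis vectors.  The coordinates 2,…,n-1 are
-- represented by Fin (n ∸ 2), with an offset of 2.
data _⟶⟨_⟩_ {n} : Flow n → Vec ℤ (n ∸ 2) → Flow n → Set where
  []  : ∀ {f} → f ⟶⟨ 0ᵛ ⟩ f
  _∷_ : ∀ {f g h s k v} → Move (2 + toℕ k) f g s → g ⟶⟨ v ⟩ h → f ⟶⟨ ±e s k ⊞ v ⟩ h

IsCoordinateVector : ∀ {n} → MaximalClique n → Vec ℤ (n ∸ 2) → Set
IsCoordinateVector {n} C v = Σ[ f ∈ Flow n ] Σ[ g ∈ Flow n ]
  (∀ e → value f e ≡ φ₀ e) × f ⟶⟨ v ⟩ g × (∀ e → + value g e ≡ φ C e)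

GridAdjacent : ∀ {d} → Vec ℤ d → Vec ℤ d → Set
GridAdjacent u v = ∃[ s ] ∃[ k ] v ≡ u ⊞ ±e s k

{-# OPTIONS --safe #-}
-- Prefixes at a vertex are totally ordered, and a clique C can be read off from
-- its prefixes: at an inner vertex i, those continued by xᵢ are all below or equal
-- to those continued by yᵢ.  A prefix which no route of C blocks extends greedily to
-- a route compatible with C, hence in C by maximality; so exactly one prefix is
-- continued by both edges.  This yields conservation for φ(C) and shows that the
-- numbers φ(C)(yᵢ) determine the prefixes of C vertex by vertex, hence C.
--
-- The move mᵢ⁺ adds one to f(yᵢ) and subtracts one from f(yᵢ₊₁), so that the i-th
-- coordinate of 𝐱 is f(y₂) + … + f(yᵢ).  Every flow reaches φ₀ by applying mᵢ⁻ at the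
-- last i with f(yᵢ) > 0, which decreases the sum of the coordinates.
--
-- Let C ∖ {R} = D ∖ {S}, and let i be the first index at which φ(C)(yᵢ) and φ(D)(yᵢ)
-- differ, φ(C)(yᵢ) being the larger one.  Then R continues its prefix at i with yᵢ
-- xᵢ₊₂, and S with xᵢ yᵢ₊₁: the two are extremal at the vertices i + 2 and i + 1.
-- From the vertex i + 3 on, they occupy the same position among the common prefixes,
-- and the prefix shared by both edges forces them to take the same edges.  Hence
-- φ(C) and φ(D) differ by the change made by mᵢ⁺.
module Submission where

open import Algebra.Bundles using (AbelianGroup)
open import Algebra.Properties.Group using (∙-cancelˡ)
open import Data.Bool.Base using (Bool; T; _∨_; true; false; if_then_else_)
open import Data.Bool.ListAction using (any)
open import Data.Bool.Properties using (T-∨; T?; T-≡; ¬-not)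
open import Data.Fin.Base using (Fin; toℕ; fromℕ<; zero; suc)
open import Data.Fin.Properties using (toℕ-fromℕ<; toℕ<n)
open import Data.Integer.Base as ℤ using (ℤ; +_; 0ℤ; 1ℤ; _◃_)
import Data.Integer.Properties as ℤ
import Data.Integer.Tactic.RingSolver as ℤ
open import Data.List.Base using (List; filter; []; _∷_; _++_; [_]; map; length)
open import Data.List.Extrema.Nat
  using (argmax; argmin; argmax-all; argmin-all; f[xs]≤f[argmax]; f[argmin]≤f[xs])
open import Data.List.Membership.Propositional using (_∈_; find; lose; _∉_)
open import Data.List.Membership.Propositional.Properties
  using (∈-filter⁺; ∈-filter⁻; ∈-∃++; ∈-++⁺ˡ; ∈-++⁺ʳ; ∈-++⁻; ∈-map⁺; ∈-map⁻)
open import Data.List.Membership.Propositional.Properties.WithK using (unique∧set⇒bag)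
open import Data.List.Properties using (length-++; length-map)
open import Data.List.Relation.Binary.BagAndSetEquality using (∼bag⇒↭)
open import Data.List.Relation.Binary.Disjoint.Propositional using (Disjoint)
open import Data.List.Relation.Binary.Permutation.Propositional using (_↭_; ↭-sym; ↭⇒↭ₛ)
open import Data.List.Relation.Binary.Permutation.Propositional.Properties
  using (shift; ∈-resp-↭; ↭-length; map⁺)
import Data.List.Relation.Binary.Permutation.Setoid.Properties as Permutationₛ
open import Data.List.Relation.Binary.Subset.Propositional using (_⊆_)
open import Data.List.Relation.Unary.All as All using ([]; _∷_)
open import Data.List.Relation.Unary.All.Properties using (all-filter; ¬Any⇒All¬)
open import Data.List.Relation.Unary.AllPairs using ([]; _∷_)
open import Data.List.Relation.Unary.Any using (any?; here; there)
open import Data.List.Relation.Unary.Any.Properties using (any⁺; any⁻)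
open import Data.List.Relation.Unary.Unique.Propositional using (Unique)
import Data.List.Relation.Unary.Unique.Propositional.Properties as Uniqueₚ
open import Data.Nat.Base
open import Data.Nat.Induction using (<-wellFounded)
open import Data.Nat.ListAction using (sum)
open import Data.Nat.ListAction.Properties using (sum-↭)
open import Data.Nat.Properties
import Data.Nat.Tactic.RingSolver as ℕ
open import Data.Product.Base using (Σ-syntax; ∃-syntax; _×_; _,_; proj₁; proj₂)
open import Data.Sign.Base as Sign using (Sign)
open import Data.Sum.Base using (_⊎_; inj₁; inj₂; [_,_]′)
open import Data.Unit.Base using (⊤; tt)
open import Data.Vec.Base using (Vec; _∷_; lookup; tabulate)
open import Data.Vec.Properties
  using (lookup-zipWith; lookup-replicate; lookup∘tabulate; tabulate∘lookup; tabulate-cong)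
open import Defs
open import Function.Base using (_∘_)
open import Function.Bundles using (Equivalence; mk⇔; _⇔_)
open import Induction.WellFounded using (Acc; acc)
open import Relation.Binary.Construct.Closure.ReflexiveTransitive using (ε; _◅_; _◅◅_)
open import Relation.Binary.Construct.Closure.ReflexiveTransitive.Properties using (◅◅-assoc)
open import Relation.Binary.Definitions using (DecidableEquality; tri<; tri≈; tri>; Tri)
open import Relation.Binary.PropositionalEquality hiding ([_])
open import Relation.Nullary
open import Relation.Nullary.Decidable using (isYes; toWitness; fromWitness; map′; decidable-stable)
open import Relation.Unary using (Decidable)

-- The prefix order

module _ {n : ℕ} where

  infix 4 _≟ᴱ_ _≟ᴾ_

  _≟ᴱ_ : DecidableEquality (Edge n)
  x i _ _ ≟ᴱ x j _ _ with i ≟ j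
  ... | yes refl = yes refl
  ... | no i≢j   = no λ { refl → i≢j refl }
  x _ _ _ ≟ᴱ y _ _   = no λ ()
  y _ _   ≟ᴱ x _ _ _ = no λ ()
  y i _   ≟ᴱ y j _ with i ≟ j
  ... | yes refl = yes refl
  ... | no i≢j   = no λ { refl → i≢j refl }

  starts : ∀ {i j} (a : Arc n i j) → source (Arc.edge a) ≡ i
  starts (arc _ s _) = recompute (_ ≟ _) s

  ends : ∀ {i j} (a : Arc n i j) → target (Arc.edge a) ≡ j
  ends (arc _ _ t) = recompute (_ ≟ _) t

  _≟ᴾ_ : ∀ {i j} → DecidableEquality (Path n i j)
  ε ≟ᴾ ε       = yes refl
  ε ≟ᴾ (_ ◅ _) = no λ ()
  (_ ◅ _) ≟ᴾ ε = no λ ()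
  (arc e _ t ◅ P) ≟ᴾ (arc f _ u ◅ Q)
    with e ≟ᴱ f | recompute (target e ≟ _) t | recompute (target f ≟ _) u
  ... | no e≢f   | _    | _ = no λ { refl → e≢f refl }
  ... | yes refl | refl | refl with P ≟ᴾ Q
  ...   | yes refl = yes refl
  ...   | no P≢Q   = no λ { refl → P≢Q refl }

  infixl 5 _∷ʳ_

  _∷ʳ_ : ∀ {i j k} → Path n i j → Arc n j k → Path n i k
  P ∷ʳ a = P ◅◅ a ◅ ε

  ∷ʳ-◅◅ : ∀ {i j k l} (P : Path n i j) (a : Arc n j k) (Q : Path n k l) →
          (P ∷ʳ a) ◅◅ Q ≡ P ◅◅ a ◅ Q
  ∷ʳ-◅◅ P a Q = ◅◅-assoc P (a ◅ ε) Q

  -- `Star` exposes the first arc of a path, while prefixes are compared from their ends; this view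
  -- exposes the last arc.
  data Last {i} : ∀ {k} → Path n i k → Set where
    nil  : Last ε
    snoc : ∀ {j k} (P : Path n i j) (a : Arc n j k) → Last (P ∷ʳ a)

  last : ∀ {i k} (P : Path n i k) → Last P
  last ε = nil
  last (a ◅ P) with last P
  ... | nil       = snoc ε a
  ... | snoc P′ b = snoc (a ◅ P′) b

  -- Since 2¹ + … + 2ᵏ⁻¹ < 2ᵏ, a prefix ending in x k outweighs every prefix
  -- ending in y (k ∸ 1), whence ≺ᵖ becomes the order of the codes.
  weight : Edge n → ℕ
  weight (x i _ _) = 2 ^ i
  weight (y _ _)   = 0

  code : ∀ {i j} → Path n i j → ℕ
  code ε       = 0
  code (a ◅ P) = weight (Arc.edge a) + code P

  code-◅◅ : ∀ {i j k} (P : Path n i j) (Q : Path n j k) → code (P ◅◅ Q) ≡ code P + code Q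
  code-◅◅ ε       Q = refl
  code-◅◅ (a ◅ P) Q rewrite code-◅◅ P Q = sym (+-assoc (weight (Arc.edge a)) _ _)

  ◅◅-monoˡ-< : ∀ {i j k} {P P′ : Path n i j} (Q : Path n j k) →
               code P < code P′ → code (P ◅◅ Q) < code (P′ ◅◅ Q)
  ◅◅-monoˡ-< {P = P} {P′} Q P<P′ rewrite code-◅◅ P Q | code-◅◅ P′ Q = +-monoˡ-< (code Q) P<P′

  ◅◅-monoˡ-≤ : ∀ {i j k} {P P′ : Path n i j} (Q : Path n j k) →
               code P ≤ code P′ → code (P ◅◅ Q) ≤ code (P′ ◅◅ Q)
  ◅◅-monoˡ-≤ {P = P} {P′} Q P≤P′ rewrite code-◅◅ P Q | code-◅◅ P′ Q = +-monoˡ-≤ (code Q) P≤P′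

  arc-< : 2 ≤ n → ∀ {i j} → Arc n i j → i < j
  arc-< 2≤n a = subst₂ _<_ (starts a) (ends a) (source<target 2≤n (Arc.edge a))

  path-≤ : 2 ≤ n → ∀ {i j} → Path n i j → i ≤ j
  path-≤ 2≤n ε       = ≤-refl
  path-≤ 2≤n (a ◅ P) = ≤-trans (<⇒≤ (arc-< 2≤n a)) (path-≤ 2≤n P)

  no-return : 2 ≤ n → ∀ {i j} → Arc n i j → ¬ Path n j i
  no-return 2≤n a P = <⇒≱ (arc-< 2≤n a) (path-≤ 2≤n P)

  ε-unique : 2 ≤ n → ∀ {i} (P : Path n i i) → P ≡ ε
  ε-unique 2≤n ε       = refl
  ε-unique 2≤n (a ◅ P) = contradiction P (no-return 2≤n a)

  ◅-injective : ∀ {i j j′ k} {a : Arc n i j} {b : Arc n i j′} {P : Path n j k} {Q : Path n j′ k} →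
                _≡_ {A = Path n i k} (a ◅ P) (b ◅ Q) →
                Σ[ e ∈ j ≡ j′ ] subst (Arc n i) e a ≡ b × subst (λ h → Path n h k) e P ≡ Q
  ◅-injective refl = refl , refl , refl

  -- Arcs increase the vertex, so a path visits `j` only once and can be cut there in one way only.
  split-unique : 2 ≤ n → ∀ {i j k} (P P′ : Path n i j) {Q Q′ : Path n j k} →
                 P ◅◅ Q ≡ P′ ◅◅ Q′ → P ≡ P′ × Q ≡ Q′
  split-unique 2≤n ε       ε        eq = refl , eq
  split-unique 2≤n ε       (a ◅ P′) eq = contradiction P′ (no-return 2≤n a)
  split-unique 2≤n (a ◅ P) ε        eq = contradiction P (no-return 2≤n a)
  split-unique 2≤n (a ◅ P) (b ◅ P′) eq with ◅-injective eq
  ... | refl , refl , eq′ with split-unique 2≤n P P′ eq′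
  ...   | refl , eq″ = refl , eq″

  -- An arc from `i` to `j` weighs at most `2 ^ j - 2 ^ i`, with equality for slack edges, and these
  -- bounds telescope along the path.
  code-bound : 2 ≤ n → ∀ {i k} (P : Path n i k) → code P + 2 ^ i ≤ 2 ^ k
  code-bound 2≤n ε = ≤-refl
  code-bound 2≤n {i} {k} (_◅_ {j = h} a P) = begin
    weight (Arc.edge a) + code P + 2 ^ i   ≡⟨ cong (_+ 2 ^ i) (+-comm (weight (Arc.edge a)) (code P)) ⟩
    code P + weight (Arc.edge a) + 2 ^ i   ≡⟨ +-assoc (code P) _ _ ⟩
    code P + (weight (Arc.edge a) + 2 ^ i) ≤⟨ +-monoʳ-≤ (code P) (step a) ⟩
    code P + 2 ^ h                         ≤⟨ code-bound 2≤n P ⟩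
    2 ^ k                                  ∎
    where
    open ≤-Reasoning
    step : ∀ {i j} (a : Arc n i j) → weight (Arc.edge a) + 2 ^ i ≤ 2 ^ j
    step a@(arc (x i _ _) _ _) with starts a | ends a
    ... | refl | refl rewrite +-identityʳ (2 ^ i) = ≤-refl
    step a@(arc (y i _) _ _) = ^-monoʳ-≤ 2 (<⇒≤ (arc-< 2≤n a))

  code-prefix : 2 ≤ n → ∀ {k} (P : Path n 1 k) → code P < 2 ^ k
  code-prefix 2≤n P = ≤-trans (m≤m+n (suc (code P)) 1)
    (≤-trans (≤-reflexive (sym (+-suc (code P) 1))) (code-bound 2≤n P))

  -- The nonslack arc weighs nothing and starts at most at `suc k`, so the left code stays below
  -- `2 ^ suc k`, which is the weight of the slack arc alone.
  ≺ⁱⁿ⇒< : 2 ≤ n → ∀ {h h′ j} {a : Arc n h j} {a′ : Arc n h′ j} → Arc.edge a ≺ⁱⁿ Arc.edge a′ →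
          (P : Path n 1 h) (P′ : Path n 1 h′) → code (P ∷ʳ a) < code (P′ ∷ʳ a′)
  ≺ⁱⁿ⇒< 2≤n {a = a@(arc (y k _) _ _)} {a′@(arc (x .(suc k) _ _) _ _)} y≺x P P′
    rewrite code-◅◅ P (a ◅ ε) | code-◅◅ P′ (a′ ◅ ε) | +-identityʳ (code P) | +-identityʳ (2 ^ suc k) =
    <-≤-trans (code-prefix 2≤n P) (≤-trans (^-monoʳ-≤ 2 h≤1+k) (m≤n+m _ (code P′)))
    where
    h≤1+k = subst (_≤ suc k) (starts a) (⊔-lub (s≤s z≤n) (n≤1+n k))

  ≺ᵖ⇒< : 2 ≤ n → ∀ {k} {P P′ : Path n 1 k} → P ≺ᵖ P′ → code P < code P′
  ≺ᵖ⇒< 2≤n (diverge {a = a} {a′} a≺a′ P P′ common)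
    rewrite sym (∷ʳ-◅◅ P a common) | sym (∷ʳ-◅◅ P′ a′ common) =
    ◅◅-monoˡ-< {P = P ∷ʳ a} {P′ ∷ʳ a′} common (≺ⁱⁿ⇒< 2≤n a≺a′ P P′)

  ≺ᵖ-∷ʳ : ∀ {j k} {P P′ : Path n 1 j} (a : Arc n j k) → P ≺ᵖ P′ → (P ∷ʳ a) ≺ᵖ (P′ ∷ʳ a)
  ≺ᵖ-∷ʳ b (diverge {a = a} {a′} a≺a′ P P′ common)
    rewrite ◅◅-assoc P (a ◅ common) (b ◅ ε) | ◅◅-assoc P′ (a′ ◅ common) (b ◅ ε) =
    diverge a≺a′ P P′ (common ∷ʳ b)

  target-y : ∀ {i k} .(p : i < n) → k < n → target (y i p) ≡ k → k ≡ 2 + i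
  target-y {i} p k<n refl with ⊓-sel (2 + i) n
  ... | inj₁ eq = eq
  ... | inj₂ eq = contradiction (subst (_< n) eq k<n) (<-irrefl refl)

  data Incoming {k} : ∀ {h h′} → Arc n h k → Arc n h′ k → Set where
    less    : ∀ {h h′} {a : Arc n h k} {b : Arc n h′ k} → Arc.edge a ≺ⁱⁿ Arc.edge b → Incoming a b
    equal   : ∀ {h} {a : Arc n h k} → Incoming a a
    greater : ∀ {h h′} {a : Arc n h k} {b : Arc n h′ k} → Arc.edge b ≺ⁱⁿ Arc.edge a → Incoming a b

  -- Below `n` only `x (k - 1)` and `y (k - 2)` can enter `k`, so distinct arcs are comparable; at
  -- `n` a third edge enters.
  incoming : ∀ {k} → k < n → ∀ {h h′} (a : Arc n h k) (b : Arc n h′ k) → Incoming a b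
  incoming k<n a@(arc (x i p q) _ _) b@(arc (x j _ _) _ _) with trans (ends a) (sym (ends b))
  ... | refl with trans (sym (starts a)) (starts b)
  ...   | refl = equal
  incoming k<n a@(arc (x i p q) _ _) b@(arc (y j r) _ _) with trans (ends a) (target-y r k<n (ends b))
  ... | refl = greater y≺x
  incoming k<n a@(arc (y i p) _ _) b@(arc (x j _ _) _ _) with trans (ends b) (target-y p k<n (ends a))
  ... | refl = less y≺x
  incoming k<n a@(arc (y i p) _ _) b@(arc (y j r) _ _)
    with trans (sym (target-y p k<n (ends a))) (target-y r k<n (ends b))
  ... | refl with trans (sym (starts a)) (starts b)
  ...   | refl = equal

  -- The last arcs decide unless they coincide; then the comparison passes to their common source,
  -- which is a smaller vertex.
  ≺ᵖ-total : 2 ≤ n → ∀ {k} → k < n → (P P′ : Path n 1 k) → P ≺ᵖ P′ ⊎ P ≡ P′ ⊎ P′ ≺ᵖ P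
  ≺ᵖ-total 2≤n {k} k<n P P′ = go k (<-wellFounded k) k<n P P′
    where
    go : ∀ k → Acc _<_ k → k < n → (P P′ : Path n 1 k) → P ≺ᵖ P′ ⊎ P ≡ P′ ⊎ P′ ≺ᵖ P
    go k (acc rs) k<n P P′ with last P | last P′
    ... | nil      | _         = inj₂ (inj₁ (sym (ε-unique 2≤n _)))
    ... | snoc P a | nil       = contradiction P (no-return 2≤n a)
    ... | snoc P a | snoc P′ b with incoming k<n a b
    ...   | less a≺b    = inj₁ (diverge a≺b P P′ ε)
    ...   | greater b≺a = inj₂ (inj₂ (diverge b≺a P′ P ε))
    ...   | equal with go _ (rs (arc-< 2≤n a)) (<-trans (arc-< 2≤n a) k<n) P P′
    ...     | inj₁ P≺P′        = inj₁ (≺ᵖ-∷ʳ a P≺P′)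
    ...     | inj₂ (inj₁ refl) = inj₂ (inj₁ refl)
    ...     | inj₂ (inj₂ P′≺P) = inj₂ (inj₂ (≺ᵖ-∷ʳ a P′≺P))

  -- Totality makes the implication `≺ᵖ⇒<` reversible: equal codes exclude both strict comparisons.
  code-injective : 2 ≤ n → ∀ {k} → k < n → {P P′ : Path n 1 k} → code P ≡ code P′ → P ≡ P′
  code-injective 2≤n k<n {P} {P′} eq with ≺ᵖ-total 2≤n k<n P P′
  ... | inj₁ P≺P′        = contradiction (≺ᵖ⇒< 2≤n P≺P′) (<-irrefl eq)
  ... | inj₂ (inj₁ P≡P′) = P≡P′
  ... | inj₂ (inj₂ P′≺P) = contradiction (≺ᵖ⇒< 2≤n P′≺P) (<-irrefl (sym eq))

  <⇒≺ᵖ : 2 ≤ n → ∀ {k} → k < n → {P P′ : Path n 1 k} → code P < code P′ → P ≺ᵖ P′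
  <⇒≺ᵖ 2≤n k<n {P} {P′} P<P′ with ≺ᵖ-total 2≤n k<n P P′
  ... | inj₁ P≺P′        = P≺P′
  ... | inj₂ (inj₁ refl) = contradiction P<P′ (<-irrefl refl)
  ... | inj₂ (inj₂ P′≺P) = contradiction P<P′ (<-asym (≺ᵖ⇒< 2≤n P′≺P))

-- Maximal cliques

◅◅-ε : ∀ {n i j} (P : Path n i j) → P ◅◅ ε ≡ P
◅◅-ε ε       = refl
◅◅-ε (a ◅ P) = cong (a ◅_) (◅◅-ε P)

xArc : ∀ {n} k → .(1 ≤ k) → .(k < n) → Arc n k (suc k)
xArc k 1≤k k<n = arc (x k 1≤k k<n) refl refl

yArc : ∀ {n} k → .(1 ≤ k) → .(k < n) → Arc n k ((2 + k) ⊓ n)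
yArc k 1≤k k<n = arc (y k k<n) (m≤n⇒m⊔n≡n 1≤k) refl

data Outgoing {n k} .(1≤k : 1 ≤ k) .(k<n : k < n) : ∀ {h} → Arc n k h → Set where
  isX : Outgoing 1≤k k<n (xArc k 1≤k k<n)
  isY : Outgoing 1≤k k<n (yArc k 1≤k k<n)

-- From `k = 2` on, the maximum in `source` has no effect, and `k` is left by `x k` and `y k` alone;
-- vertex 1 is also left by `y 0`.
outgoing : ∀ {n k h} (2≤k : 2 ≤ k) .(k<n : k < n) (a : Arc n k h) → Outgoing (<⇒≤ 2≤k) k<n a
outgoing 2≤k k<n a@(arc (x i _ _) _ _) with starts a | ends a
... | refl | refl = isX
outgoing 2≤k k<n a@(arc (y zero _) _ _) = contradiction 2≤k (subst (λ k → ¬ 2 ≤ k) (starts a) λ { (s≤s ()) })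
outgoing 2≤k k<n a@(arc (y (suc i) _) _ _) with starts a | ends a
... | refl | refl = isY

module _ {n : ℕ} (2≤n : 2 ≤ n) where

  Conflict-sym : {R R′ : Route n} → Conflict R R′ → Conflict R′ R
  Conflict-sym (i , P , P′ , Q , Q′ , inner , p , p′ , inj₁ c) = i , P′ , P , Q′ , Q , inner , p′ , p , inj₂ c
  Conflict-sym (i , P , P′ , Q , Q′ , inner , p , p′ , inj₂ c) = i , P′ , P , Q′ , Q , inner , p′ , p , inj₁ c

  -- The conflict is moved forward to the vertex at which the suffixes diverge.
  Conflict⇒diverge : ∀ {R R′ : Route n} {i} (P P′ : Path n 1 i) {Q Q′ : Path n i n} →
    R ≡ P ◅◅ Q → R′ ≡ P′ ◅◅ Q′ → P ≺ᵖ P′ → Q′ ≺ˢ Q →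
    ∃[ k ] ∃[ h ] ∃[ h′ ] Σ[ A ∈ Path n 1 k ] Σ[ A′ ∈ Path n 1 k ]
    Σ[ a ∈ Arc n k h ] Σ[ a′ ∈ Arc n k h′ ] Σ[ B ∈ Path n h n ] Σ[ B′ ∈ Path n h′ n ]
      R ≡ A ◅◅ a ◅ B × R′ ≡ A′ ◅◅ a′ ◅ B′ × code A < code A′ × Arc.edge a′ ≺ᵒᵘᵗ Arc.edge a
  Conflict⇒diverge P P′ refl refl P≺P′ (diverge {a = a′} {a} a′≺a common B′ B) =
    _ , _ , _ , P ◅◅ common , P′ ◅◅ common , a , a′ , B , B′ ,
    sym (◅◅-assoc P common (a ◅ B)) , sym (◅◅-assoc P′ common (a′ ◅ B′)) ,
    ◅◅-monoˡ-< {P = P} {P′} common (≺ᵖ⇒< 2≤n P≺P′) , a′≺a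

  ¬Conflict-refl : (R : Route n) → ¬ Conflict R R
  ¬Conflict-refl R (i , P , P′ , Q , Q′ , _ , refl , eq , c) with split-unique 2≤n P P′ eq
  ... | refl , _ with c
  ...   | inj₁ (P≺P , _) = <-irrefl refl (≺ᵖ⇒< 2≤n P≺P)
  ...   | inj₂ (P≺P , _) = <-irrefl refl (≺ᵖ⇒< 2≤n P≺P)

  module _ (C : MaximalClique n) where

    Begins : ∀ {k} → Path n 1 k → Set
    Begins {k} P = Σ[ Q ∈ Path n k n ] (P ◅◅ Q) ∈ᴿ routes C

    Begins? : ∀ {k} → Decidable (Begins {k})
    Begins? {k} P = map′
      (λ Q∈ → let Q , _ , PQ∈C = find Q∈ in Q , PQ∈C)
      (λ (Q , PQ∈C) → lose (paths-complete 2≤n Q) PQ∈C)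
      (any? (λ Q → T? (routes C (P ◅◅ Q))) (paths n k n))

    Begins-◅ : ∀ {j k} (P : Path n 1 j) (a : Arc n j k) (Q : Path n k n) →
               (P ◅◅ a ◅ Q) ∈ᴿ routes C → Begins (P ∷ʳ a)
    Begins-◅ P a Q PaQ∈C = Q , subst (_∈ᴿ routes C) (sym (∷ʳ-◅◅ P a Q)) PaQ∈C

    Begins-init : ∀ {i j} (P : Path n 1 i) (Q : Path n i j) → Begins (P ◅◅ Q) → Begins P
    Begins-init P Q (Q′ , ∈C) = Q ◅◅ Q′ , subst (_∈ᴿ routes C) (◅◅-assoc P Q Q′) ∈C

    -- Routes of `C` extending the two prefixes would conflict at `k`. This vertex is inner: at 1
    -- the empty prefix is the only one, and no arc leaves `n`.
    noncrossing : ∀ {k h h′} {P P′ : Path n 1 k} {a : Arc n k h} {a′ : Arc n k h′} →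
                  code P < code P′ → Arc.edge a′ ≺ᵒᵘᵗ Arc.edge a →
                  Begins (P ∷ʳ a) → ¬ Begins (P′ ∷ʳ a′)
    noncrossing {k} {P = P} {P′} {a} {a′} P<P′ a′≺a (Q , ∈C) (Q′ , ∈C′) =
      MaximalClique.isClique C _ _ ∈C ∈C′
        (k , P , P′ , a ◅ Q , a′ ◅ Q′ , (2≤k , k<n) , ∷ʳ-◅◅ P a Q , ∷ʳ-◅◅ P′ a′ Q′ ,
         inj₁ (<⇒≺ᵖ 2≤n k<n P<P′ , diverge a′≺a ε Q′ Q))
      where
      k<n : k < n
      k<n = <-≤-trans (arc-< 2≤n a) (path-≤ 2≤n Q)
      2≤k : 2 ≤ k
      2≤k with m≤n⇒m<n∨m≡n (path-≤ 2≤n P)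
      ... | inj₁ 1<k = 1<k
      ... | inj₂ refl rewrite ε-unique 2≤n P =
        contradiction P<P′ (subst (λ A → ¬ 0 < code A) (sym (ε-unique 2≤n P′)) λ ())

    -- Since conflicts can be moved to the vertex where the suffixes diverge, it suffices to
    -- compare, one arc at a time, `P` with those prefixes of `C` that leave `k` by the other edge.
    Compatible : ∀ {k h} → Path n 1 k → Arc n k h → Set
    Compatible {k} P a = ∀ {h} (a′ : Arc n k h) (P′ : Path n 1 k) → Begins (P′ ∷ʳ a′) →
      (Arc.edge a ≺ᵒᵘᵗ Arc.edge a′ → ¬ code P′ < code P) ×
      (Arc.edge a′ ≺ᵒᵘᵗ Arc.edge a → ¬ code P < code P′)

    CompatibleAlong : ∀ {k m} → Path n 1 k → Path n k m → Set
    CompatibleAlong P ε       = ⊤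
    CompatibleAlong P (a ◅ Q) = Compatible P a × CompatibleAlong (P ∷ʳ a) Q

    CompatibleAlong-◅◅ : ∀ {i j k} (P : Path n 1 i) (A : Path n i j) {B : Path n j k} →
      CompatibleAlong P A → CompatibleAlong (P ◅◅ A) B → CompatibleAlong P (A ◅◅ B)
    CompatibleAlong-◅◅ P ε {B} _ PB = subst (λ A → CompatibleAlong A B) (◅◅-ε P) PB
    CompatibleAlong-◅◅ P (a ◅ A) {B} (Pa , PA) PB =
      Pa , CompatibleAlong-◅◅ (P ∷ʳ a) A PA (subst (λ A → CompatibleAlong A B) (sym (∷ʳ-◅◅ P a A)) PB)

    CompatibleAlong⇒Compatible : ∀ {i k h m} (P : Path n 1 i) (A : Path n i k) {a : Arc n k h} {B : Path n h m} →
      CompatibleAlong P (A ◅◅ a ◅ B) → Compatible (P ◅◅ A) a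
    CompatibleAlong⇒Compatible P ε {a} (Pa , _) = subst (λ A → Compatible A a) (sym (◅◅-ε P)) Pa
    CompatibleAlong⇒Compatible P (b ◅ A) {a} (_ , PA) =
      subst (λ A → Compatible A a) (∷ʳ-◅◅ P b A) (CompatibleAlong⇒Compatible (P ∷ʳ b) A PA)

    member-compatible : ∀ {k} (P : Path n 1 k) (Q : Path n k n) →
                        (P ◅◅ Q) ∈ᴿ routes C → CompatibleAlong P Q
    member-compatible P ε       _   = tt
    member-compatible P (a ◅ Q) PaQ∈C =
      (λ a′ P′ P′a′ → (λ a≺a′ P′<P → noncrossing P′<P a≺a′ P′a′ Pa) ,
                      (λ a′≺a P<P′ → noncrossing P<P′ a′≺a Pa P′a′)) ,
      member-compatible (P ∷ʳ a) Q (subst (_∈ᴿ routes C) (sym (∷ʳ-◅◅ P a Q)) PaQ∈C)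
      where
      Pa : Begins (P ∷ʳ a)
      Pa = Begins-◅ P a Q PaQ∈C

    prefix-compatible : ∀ {i j} (P : Path n 1 i) (A : Path n i j) → Begins (P ◅◅ A) → CompatibleAlong P A
    prefix-compatible P ε       _ = tt
    prefix-compatible P (a ◅ A) b with member-compatible P ((a ◅ A) ◅◅ proj₁ b)
                                    (subst (_∈ᴿ routes C) (◅◅-assoc P (a ◅ A) (proj₁ b)) (proj₂ b))
    ... | Pa , _ = Pa , prefix-compatible (P ∷ʳ a) A (subst Begins (sym (∷ʳ-◅◅ P a A)) b)

    -- Adjoining `R` to `C` keeps it a clique: a conflict with `R`, moved to the vertex where the
    -- suffixes diverge, contradicts compatibility there. Maximality then applies.
    compatible⇒member : (R : Route n) → CompatibleAlong ε R → R ∈ᴿ routes C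
    compatible⇒member R cR =
      MaximalClique.maximal C D D-clique (λ S S∈C → Equivalence.from (T-∨ {routes C S}) (inj₁ S∈C))
        R (Equivalence.from (T-∨ {routes C R}) (inj₂ (fromWitness {a? = R ≟ᴾ R} refl)))
      where
      D : RouteSet n
      D S = routes C S ∨ isYes (S ≟ᴾ R)

      no-conflict : ∀ S → S ∈ᴿ routes C → ¬ Conflict R S
      no-conflict S S∈C (i , P , P′ , Q , Q′ , _ , p , p′ , inj₁ (P≺P′ , Q′≺Q))
        with Conflict⇒diverge P P′ p p′ P≺P′ Q′≺Q
      ... | _ , _ , _ , A , A′ , a , a′ , B , B′ , refl , refl , A<A′ , a′≺a =
        proj₂ (CompatibleAlong⇒Compatible ε A cR a′ A′ (Begins-◅ A′ a′ B′ S∈C)) a′≺a A<A′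
      no-conflict S S∈C (i , P , P′ , Q , Q′ , _ , p , p′ , inj₂ (P′≺P , Q≺Q′))
        with Conflict⇒diverge P′ P p′ p P′≺P Q≺Q′
      ... | _ , _ , _ , A′ , A , a′ , a , B′ , B , refl , refl , A′<A , a≺a′ =
        proj₁ (CompatibleAlong⇒Compatible ε A cR a′ A′ (Begins-◅ A′ a′ B′ S∈C)) a≺a′ A′<A

      D-clique : IsClique D
      D-clique S S′ S∈D S′∈D c
        with Equivalence.to (T-∨ {routes C S}) S∈D | Equivalence.to (T-∨ {routes C S′}) S′∈D
      ... | inj₁ S∈C | inj₁ S′∈C = MaximalClique.isClique C S S′ S∈C S′∈C c
      ... | inj₁ S∈C | inj₂ S′≡R with toWitness {a? = S′ ≟ᴾ R} S′≡R
      ...   | refl = no-conflict S S∈C (Conflict-sym c)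
      D-clique S S′ S∈D S′∈D c | inj₂ S≡R | inj₁ S′∈C with toWitness {a? = S ≟ᴾ R} S≡R
      ...   | refl = no-conflict S′ S′∈C c
      D-clique S S′ S∈D S′∈D c | inj₂ S≡R | inj₂ S′≡R
        with toWitness {a? = S ≟ᴾ R} S≡R | toWitness {a? = S′ ≟ᴾ R} S′≡R
      ...   | refl | refl = ¬Conflict-refl R c

    -- If two routes of C block the continuation of P by both edges,
    -- then they are in conflict with each other.
    compatible-suffix : ∀ {k} → k ≤ n → (P : Path n 1 k) →
                        ¬ ¬ (Σ[ Q ∈ Path n k n ] CompatibleAlong P Q)
    compatible-suffix k≤n = go n k≤n (m≤m+n n _)
      where
      -- `l` bounds the number of remaining arcs; `n ≤ l + k` is preserved because each arc
      -- increases the vertex.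
      go : ∀ l {k} → k ≤ n → n ≤ l + k → (P : Path n 1 k) → ¬ ¬ (Σ[ Q ∈ Path n k n ] CompatibleAlong P Q)
      go l {k} k≤n n≤l+k P none with m≤n⇒m<n∨m≡n k≤n
      go l       k≤n n≤l+k P none | inj₂ refl = none (ε , tt)
      go zero    k≤n n≤k   P none | inj₁ k<n = <⇒≱ k<n n≤k
      go (suc l) {k} k≤n n≤l+k P none | inj₁ k<n =
        blocked (xArc k 1≤k k<n) λ { (arc _ _ _) P′ P′y → (λ { x≺y P′<P →
        blocked (yArc k 1≤k k<n) λ { (arc _ _ _) P″ P″x → (λ ()) , (λ { x≺y P<P″ →
        noncrossing (<-trans P′<P P<P″) x≺y P′y P″x }) } }) , (λ ()) }
        where
        1≤k = path-≤ 2≤n P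
        blocked : ∀ {h} (a : Arc n k h) → ¬ Compatible P a
        blocked {h} a ok = go l (subst (_≤ n) (ends a) (target≤n (Arc.edge a)))
          (≤-trans n≤l+k (subst (_≤ l + h) (+-suc l k) (+-monoʳ-≤ l (arc-< 2≤n a)))) (P ∷ʳ a)
          λ (Q , c) → none (a ◅ Q , ok , c)

    begins-ε : Begins ε
    -- A compatible suffix is known only up to double negation, which suffices because `Begins` is
    -- decidable.
    begins-ε = decidable-stable (Begins? ε) λ none →
      compatible-suffix (<⇒≤ 2≤n) ε λ (Q , c) → none (Q , compatible⇒member Q c)

    -- The extended route is compatible along `P` because `P` already begins a route of `C`, at `a`
    -- by hypothesis, and beyond `a` by the choice of the suffix.
    begins-∷ʳ : ∀ {k h} (P : Path n 1 k) (a : Arc n k h) → Begins P → Compatible P a → Begins (P ∷ʳ a)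
    begins-∷ʳ {k} {h} P a bP Pa = decidable-stable (Begins? (P ∷ʳ a)) λ none →
      compatible-suffix (subst (_≤ n) (ends a) (target≤n (Arc.edge a))) (P ∷ʳ a) λ (Q , c) →
      none (Q , compatible⇒member ((P ∷ʳ a) ◅◅ Q)
        (CompatibleAlong-◅◅ ε (P ∷ʳ a) (CompatibleAlong-◅◅ ε P (prefix-compatible ε P bP) (Pa , tt)) c))

    -- The empty prefix is the only one at vertex 1, so nothing can block an edge leaving it.
    begins-first : ∀ {h} (a : Arc n 1 h) → Begins (ε ∷ʳ a)
    begins-first a = begins-∷ʳ ε a begins-ε λ a′ P′ _ →
      (λ _ ()) , (λ _ 0<P′ → n≮0 (subst (λ P → 0 < code P) (ε-unique 2≤n P′) 0<P′))

    module _ {k h} (a : Arc n k h) {P : Path n 1 k} (Pa : Begins (P ∷ʳ a)) where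

      private
        candidates : List (Path n 1 k)
        candidates = filter (λ P → Begins? (P ∷ʳ a)) (paths n 1 k)

        ∈candidates : ∀ {P} → Begins (P ∷ʳ a) → P ∈ candidates
        ∈candidates {P} Pa = ∈-filter⁺ (λ P → Begins? (P ∷ʳ a)) (paths-complete 2≤n P) Pa

      greatest : Σ[ t ∈ Path n 1 k ] Begins (t ∷ʳ a) × (∀ P → Begins (P ∷ʳ a) → code P ≤ code t)
      greatest = argmax code P candidates ,
        argmax-all code Pa (all-filter (λ P → Begins? (P ∷ʳ a)) (paths n 1 k)) ,
        λ P′ P′a → All.lookup (f[xs]≤f[argmax] P candidates) (∈candidates P′a)

    least : ∀ {k} {P : Path n 1 k} → Begins P →
            Σ[ t ∈ Path n 1 k ] Begins t × (∀ P → Begins P → code t ≤ code P)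
    least {k} {P} bP = argmin code P candidates ,
      argmin-all code bP (all-filter Begins? (paths n 1 k)) ,
      λ P′ bP′ → All.lookup (f[argmin]≤f[xs] {f = code} P candidates) (∈-filter⁺ Begins? (paths-complete 2≤n P′) bP′)
      where
      candidates : List (Path n 1 k)
      candidates = filter Begins? (paths n 1 k)

    -- The least prefix at `k` is never blocked from the slack edge, as only a smaller prefix
    -- continued by `y k` could do so; this slack edge leads to the next vertex.
    visited : ∀ k → 1 ≤ k → k < n → Σ[ P ∈ Path n 1 k ] Begins P
    begins-x : ∀ k .(1≤k : 1 ≤ k) (k<n : k < n) → Σ[ P ∈ Path n 1 k ] Begins (P ∷ʳ xArc k 1≤k k<n)

    visited 1                 _ _ = ε , begins-ε
    visited (suc k@(suc _)) _ k<n with begins-x k (s≤s z≤n) (<-trans (n<1+n k) k<n)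
    ... | P , Px = _ , Px

    begins-x k@(suc _) _ k<n with visited k (s≤s z≤n) k<n
    ... | P , bP with least bP
    ...   | t , bt , t-least = t , begins-∷ʳ t (xArc k (s≤s z≤n) k<n) bt λ a′ P′ P′a′ →
            (λ _ → ≤⇒≯ (t-least P′ (Begins-init P′ (a′ ◅ ε) P′a′))) , (λ ())

    -- `path` cuts the prefixes of `C` at `k` in two: those below it continue by the slack edge
    -- only, those above it by the nonslack edge only.
    record Shared (k : ℕ) (2≤k : 2 ≤ k) (k<n : k < n) : Set where
      private
        xₖ = xArc k (<⇒≤ 2≤k) k<n
        yₖ = yArc k (<⇒≤ 2≤k) k<n
      field
        path : Path n 1 k
        viaX : Begins (path ∷ʳ xₖ)
        viaY : Begins (path ∷ʳ yₖ)

      initial : Begins path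
      initial = Begins-init path (xₖ ◅ ε) viaX

      x⇒≤ : ∀ {P} → Begins (P ∷ʳ xₖ) → code P ≤ code path
      x⇒≤ Px = ≮⇒≥ λ t<P → noncrossing t<P x≺y viaY Px

      y⇒≥ : ∀ {P} → Begins (P ∷ʳ yₖ) → code path ≤ code P
      y⇒≥ Py = ≮⇒≥ λ P<t → noncrossing P<t x≺y Py viaX

      next : ∀ {P} → Begins P → Begins (P ∷ʳ xₖ) ⊎ Begins (P ∷ʳ yₖ)
      next (ε , _) = contradiction k<n (<-irrefl refl)
      next {P} (a ◅ Q , ∈C) with outgoing 2≤k k<n a
      ... | isX = inj₁ (Begins-◅ P a Q ∈C)
      ... | isY = inj₂ (Begins-◅ P a Q ∈C)

      ≤⇒x : ∀ {P} → Begins P → code P ≤ code path → Begins (P ∷ʳ xₖ)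
      ≤⇒x bP P≤t with next bP
      ... | inj₁ Px = Px
      ... | inj₂ Py = subst (λ P → Begins (P ∷ʳ xₖ)) (code-injective 2≤n k<n (≤-antisym (y⇒≥ Py) P≤t)) viaX

      ≥⇒y : ∀ {P} → Begins P → code path ≤ code P → Begins (P ∷ʳ yₖ)
      ≥⇒y bP t≤P with next bP
      ... | inj₁ Px = subst (λ P → Begins (P ∷ʳ yₖ)) (code-injective 2≤n k<n (≤-antisym t≤P (x⇒≤ Px))) viaY
      ... | inj₂ Py = Py

    -- The greatest prefix continued by the slack edge also continues by the nonslack one: blocking
    -- it would take a still greater prefix continued by the slack edge.
    shared : ∀ k 2≤k k<n → Shared k 2≤k k<n
    shared k 2≤k k<n with greatest (xArc k (<⇒≤ 2≤k) k<n) (proj₂ (begins-x k (<⇒≤ 2≤k) k<n))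
    ... | t , tx , t-greatest = record
      { path = t
      ; viaX = tx
      ; viaY = begins-∷ʳ t (yArc k (<⇒≤ 2≤k) k<n) (Begins-init t (xArc k (<⇒≤ 2≤k) k<n ◅ ε) tx)
          λ a′ P′ P′a′ → (λ ()) , continuesX (outgoing 2≤k k<n a′) P′a′
      }
      where
      continuesX : ∀ {h P} {a : Arc n k h} → Outgoing (<⇒≤ 2≤k) k<n a → Begins (P ∷ʳ a) →
                   Arc.edge a ≺ᵒᵘᵗ y k k<n → ¬ code t < code P
      continuesX isX Pa _ = ≤⇒≯ (t-greatest _ Pa)

-- Counting prefixes

module _ {A : Set} where

  record Removal (v : A) (xs : List A) : Set where
    constructor removal
    field
      rest : List A
      perm : xs ↭ v ∷ rest

    ∈-rest : ∀ {z} → z ∈ xs → z ≢ v → z ∈ rest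
    ∈-rest z∈xs z≢v with ∈-resp-↭ perm z∈xs
    ... | here z≡v = contradiction z≡v z≢v
    ... | there z∈ = z∈

    rest⊆ : rest ⊆ xs
    rest⊆ z∈ = ∈-resp-↭ (↭-sym perm) (there z∈)

    unique-rest : Unique xs → v ∉ rest × Unique rest
    unique-rest u with Permutationₛ.Unique-resp-↭ (setoid A) (↭⇒↭ₛ perm) u
    ... | v# ∷ u′ = (λ v∈ → All.lookup v# v∈ refl) , u′

  remove : ∀ {v xs} → v ∈ xs → Removal v xs
  remove {v} v∈xs with ∈-∃++ v∈xs
  ... | ys , zs , refl = removal (ys ++ zs) (shift v ys zs)

  length-⊆ : ∀ {xs ys : List A} → Unique xs → xs ⊆ ys → length xs ≤ length ys
  length-⊆ []         _     = z≤n
  length-⊆ (x# ∷ uxs) xs⊆ys with remove (xs⊆ys (here refl))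
  ... | r@(removal rest perm) rewrite ↭-length perm = s≤s (length-⊆ uxs λ z∈xs →
    Removal.∈-rest r (xs⊆ys (there z∈xs)) λ { refl → All.lookup x# z∈xs refl })

  length-≡ : ∀ {xs ys : List A} → Unique xs → Unique ys → xs ⊆ ys → ys ⊆ xs → length xs ≡ length ys
  length-≡ uxs uys xs⊆ys ys⊆xs = ≤-antisym (length-⊆ uxs xs⊆ys) (length-⊆ uys ys⊆xs)

  -- Once the only common element `v` is removed from `ys`, the two lists are disjoint and together
  -- exhaust `zs`.
  length-∩ : ∀ {v} {xs ys zs : List A} → Unique xs → Unique ys → Unique zs →
             xs ⊆ zs → ys ⊆ zs → (∀ {z} → z ∈ zs → z ∈ xs ⊎ z ∈ ys) →
             v ∈ xs → v ∈ ys → (∀ {z} → z ∈ xs → z ∈ ys → z ≡ v) →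
             length xs + length ys ≡ suc (length zs)
  length-∩ {v} {xs} {ys} {zs} uxs uys uzs xs⊆zs ys⊆zs zs⊆ v∈xs v∈ys only-v = begin
    length xs + length ys         ≡⟨ cong (λ l → length xs + l) (↭-length perm) ⟩
    length xs + suc (length rest) ≡⟨ +-suc (length xs) (length rest) ⟩
    suc (length xs + length rest) ≡⟨ cong suc (sym (length-++ xs)) ⟩
    suc (length (xs ++ rest))     ≡⟨ cong suc (length-≡
      (Uniqueₚ.++⁺ uxs (proj₂ (unique-rest uys)) disjoint) uzs into from) ⟩
    suc (length zs)               ∎
    where
    open ≡-Reasoning
    open Removal (remove v∈ys)
    disjoint : Disjoint xs rest
    disjoint (z∈xs , z∈rest) with only-v z∈xs (rest⊆ z∈rest)
    ... | refl = proj₁ (unique-rest uys) z∈rest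
    into : xs ++ rest ⊆ zs
    into z∈ = [ xs⊆zs , ys⊆zs ∘ rest⊆ ]′ (∈-++⁻ xs z∈)
    from : zs ⊆ xs ++ rest
    from z∈zs with zs⊆ z∈zs
    ... | inj₁ z∈xs = ∈-++⁺ˡ z∈xs
    ... | inj₂ z∈ys with ∈-resp-↭ perm z∈ys
    ...   | here refl    = ∈-++⁺ˡ v∈xs
    ...   | there z∈rest = ∈-++⁺ʳ xs z∈rest

module _ {n : ℕ} (2≤n : 2 ≤ n) (C : MaximalClique n) where

  count : Edge n → ℕ
  count e = length (prefixesBefore C e)

  private
    test : ∀ (e : Edge n) → Path n 1 (source e) → Bool
    test e P = any (λ Q → routes C (P ◅◅ arrow e ◅ Q)) (paths n (target e) n)

  ∈-prefixesBefore⁺ : ∀ {e P} → Begins 2≤n C (P ∷ʳ arrow e) → P ∈ prefixesBefore C e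
  ∈-prefixesBefore⁺ {e} {P} (Q , ∈C) = ∈-filter⁺ (T? ∘ test e) (paths-complete 2≤n P)
    (any⁺ _ (lose (paths-complete 2≤n Q) (subst (_∈ᴿ routes C) (∷ʳ-◅◅ P (arrow e) Q) ∈C)))

  ∈-prefixesBefore⁻ : ∀ {e P} → P ∈ prefixesBefore C e → Begins 2≤n C (P ∷ʳ arrow e)
  ∈-prefixesBefore⁻ {e} {P} P∈ with ∈-filter⁻ (T? ∘ test e) {xs = paths n 1 (source e)} P∈
  ... | _ , ok with find (any⁻ _ (paths n (target e) n) ok)
  ...   | Q , _ , ∈C = Begins-◅ 2≤n C P (arrow e) Q ∈C

  -- The minimum in the target of a nonslack edge need not compute, so an arc may state its head in
  -- another form; this lemma and the next pass between both forms.
  to-arrow : ∀ e {h} (t : target e ≡ h) (P : Path n 1 (source e)) →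
             Begins 2≤n C (P ∷ʳ arc e refl t) → Begins 2≤n C (P ∷ʳ arrow e)
  to-arrow e refl P Pe = Pe

  from-arrow : ∀ e {h} (t : target e ≡ h) (P : Path n 1 (source e)) →
               Begins 2≤n C (P ∷ʳ arrow e) → Begins 2≤n C (P ∷ʳ arc e refl t)
  from-arrow e refl P Pe = Pe

  prefixesBefore-unique : ∀ e → Unique (prefixesBefore C e)
  prefixesBefore-unique e = Uniqueₚ.filter⁺ (T? ∘ test e) (paths-unique n 1 (source e))

  count-first : ∀ e → source e ≡ 1 → count e ≡ 1
  count-first e s with begins-arrow (arrow e) s
    where
    begins-arrow : ∀ {k h} (a : Arc n k h) → k ≡ 1 → Σ[ P ∈ Path n 1 k ] Begins 2≤n C (P ∷ʳ a)
    begins-arrow a refl = ε , begins-first 2≤n C a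
  ... | P , Pe = length-≡ {ys = [ P ]} (prefixesBefore-unique e) (All.[] ∷ [])
    (λ {Q} _ → here (all-equal s Q P)) (λ { (here refl) → ∈-prefixesBefore⁺ Pe })
    where
    all-equal : ∀ {k} → k ≡ 1 → (P Q : Path n 1 k) → P ≡ Q
    all-equal refl P Q = trans (ε-unique 2≤n P) (sym (ε-unique 2≤n Q))

  count-x : ∀ k (2≤k : 2 ≤ k) (k<n : k < n) → 1 ≤ count (x k (<⇒≤ 2≤k) k<n)
  count-x k 2≤k k<n = length-⊆ {xs = [ Shared.path (shared 2≤n C k 2≤k k<n) ]} (All.[] ∷ [])
    λ { (here refl) → ∈-prefixesBefore⁺ (Shared.viaX (shared 2≤n C k 2≤k k<n)) }

  count-y : ∀ k .(k<n : k < n) → 1 ≤ count (y k k<n)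
  count-y 0 k<n = ≤-reflexive (sym (count-first (y 0 k<n) refl))
  count-y 1 k<n = ≤-reflexive (sym (count-first (y 1 k<n) refl))
  count-y k@(suc (suc _)) k<n = length-⊆ {xs = [ Shared.path t ]} (All.[] ∷ [])
    λ { (here refl) → ∈-prefixesBefore⁺ (Shared.viaY t) }
    where
    t = shared 2≤n C k (s≤s (s≤s z≤n)) (recompute (k <? n) k<n)

  -- Every prefix at `2 + m` arrives by one of the two incoming edges and leaves by an outgoing one,
  -- the shared prefix alone being counted twice. Subtracting one from each of the four counts
  -- yields netflow 1.
  count-conserved : ∀ m (k<n : 2 + m < n) →
    count (x (2 + m) (s≤s z≤n) k<n) + count (y (2 + m) k<n) ≡
    suc (count (x (1 + m) (s≤s z≤n) (<-trans (n<1+n _) k<n)) +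
         count (y m (<-trans (n<1+n _) (<-trans (n<1+n _) k<n))))
  count-conserved m k<n = begin
    count xₖ + count yₖ
      ≡⟨ length-∩ (prefixesBefore-unique xₖ) (prefixesBefore-unique yₖ) unique-in
           (λ P∈ → ∈-in (Begins-init 2≤n C _ (arrow xₖ ◅ ε) (∈-prefixesBefore⁻ {xₖ} P∈)))
           (λ P∈ → ∈-in (Begins-init 2≤n C _ (arrow yₖ ◅ ε) (∈-prefixesBefore⁻ {yₖ} P∈)))
           (λ P∈ → [ inj₁ ∘ ∈-prefixesBefore⁺ {xₖ} , inj₂ ∘ ∈-prefixesBefore⁺ {yₖ} ]′ (next (in-begins P∈)))
           (∈-prefixesBefore⁺ {xₖ} viaX) (∈-prefixesBefore⁺ {yₖ} viaY)
           (λ P∈x P∈y → code-injective 2≤n k<n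
             (≤-antisym (x⇒≤ (∈-prefixesBefore⁻ {xₖ} P∈x)) (y⇒≥ (∈-prefixesBefore⁻ {yₖ} P∈y)))) ⟩
    suc (length prefixes) ≡⟨ cong suc (trans (length-++ (map (_∷ʳ xIn) (prefixesBefore C x′)))
      (cong₂ _+_ (length-map (_∷ʳ xIn) (prefixesBefore C x′)) (length-map (_∷ʳ yIn) (prefixesBefore C y′)))) ⟩
    suc (count x′ + count y′) ∎
    where
    open ≡-Reasoning
    open Shared (shared 2≤n C (2 + m) (s≤s (s≤s z≤n)) k<n)
    1+m<n = <-trans (n<1+n _) k<n
    m<n = <-trans (n<1+n _) 1+m<n
    xₖ yₖ x′ y′ : Edge n
    xₖ = x (2 + m) (s≤s z≤n) k<n
    yₖ = y (2 + m) k<n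
    x′ = x (1 + m) (s≤s z≤n) 1+m<n
    y′ = y m m<n
    xIn : Arc n (1 + m) (2 + m)
    xIn = arrow x′
    yIn : Arc n (1 ⊔ m) (2 + m)
    yIn = arc y′ refl (m≤n⇒m⊓n≡m (<⇒≤ k<n))
    prefixes : List (Path n 1 (2 + m))
    prefixes = map (_∷ʳ xIn) (prefixesBefore C x′) ++ map (_∷ʳ yIn) (prefixesBefore C y′)
    ∈-in : ∀ {P} → Begins 2≤n C P → P ∈ prefixes
    ∈-in {P} bP with last P
    ... | snoc P a = via a P bP
      where
      via : ∀ {h} (a : Arc n h (2 + m)) (P : Path n 1 h) → Begins 2≤n C (P ∷ʳ a) → (P ∷ʳ a) ∈ prefixes
      via a@(arc (x i _ _) _ _) P Pa with ends a | starts a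
      ... | refl | refl = ∈-++⁺ˡ (∈-map⁺ (_∷ʳ xIn) (∈-prefixesBefore⁺ {x′} Pa))
      via a@(arc (y i p) _ _) P Pa with target-y p k<n (ends a) | starts a
      ... | refl | refl = ∈-++⁺ʳ (map (_∷ʳ xIn) (prefixesBefore C x′))
        (∈-map⁺ (_∷ʳ yIn) (∈-prefixesBefore⁺ {y′} (to-arrow y′ (ends a) P Pa)))
    in-begins : ∀ {P} → P ∈ prefixes → Begins 2≤n C P
    in-begins P∈ with ∈-++⁻ (map (_∷ʳ xIn) (prefixesBefore C x′)) P∈
    ... | inj₁ P∈x with ∈-map⁻ (_∷ʳ xIn) P∈x
    ...   | P , P∈ , refl = ∈-prefixesBefore⁻ {x′} P∈
    in-begins P∈ | inj₂ P∈y with ∈-map⁻ (_∷ʳ yIn) P∈y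
    ...   | P , P∈ , refl = from-arrow y′ (ends yIn) P (∈-prefixesBefore⁻ {y′} P∈)
    unique-in : Unique prefixes
    unique-in = Uniqueₚ.++⁺
      (Uniqueₚ.map⁺ (proj₁ ∘ split-unique 2≤n _ _) (prefixesBefore-unique x′))
      (Uniqueₚ.map⁺ (proj₁ ∘ split-unique 2≤n _ _) (prefixesBefore-unique y′))
      disjoint
      where
      disjoint : Disjoint (map (_∷ʳ xIn) (prefixesBefore C x′)) (map (_∷ʳ yIn) (prefixesBefore C y′))
      disjoint (∈xs , ∈ys) with ∈-map⁻ (_∷ʳ xIn) ∈xs | ∈-map⁻ (_∷ʳ yIn) ∈ys
      ... | P , _ , refl | P′ , _ , eq = <-irrefl (sym (cong code eq)) (≺ⁱⁿ⇒< 2≤n {a = yIn} {xIn} y≺x P′ P)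

-- Recovering a clique from its counts on the nonslack edges

module _ {n : ℕ} (2≤n : 2 ≤ n) where

  private
    inner : ∀ {m} → 2 ≤ 2 + m
    inner = s≤s (s≤s z≤n)

    sharedPath : ∀ (C : MaximalClique n) m → 2 + m < n → Path n 1 (2 + m)
    sharedPath C m k<n = Shared.path (shared 2≤n C (2 + m) inner k<n)

  BeginsIn : (C D : MaximalClique n) → ℕ → Set
  BeginsIn C D k = ∀ {P : Path n 1 k} → Begins 2≤n C P → Begins 2≤n D P

  module _ (C D : MaximalClique n) {m} (k<n : 2 + m < n) where
    private
      tC = shared 2≤n C (2 + m) inner k<n
      tD = shared 2≤n D (2 + m) inner k<n

    -- The nonslack edge continues exactly the prefixes from the shared one on, so lowering the
    -- shared prefix enlarges this set.
    y-⊆ : BeginsIn C D (2 + m) → code (sharedPath D m k<n) ≤ code (sharedPath C m k<n) →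
          ∀ {P} → P ∈ prefixesBefore C (y (2 + m) k<n) → P ∈ prefixesBefore D (y (2 + m) k<n)
    y-⊆ C⊆D tD≤tC P∈ = ∈-prefixesBefore⁺ 2≤n D (Shared.≥⇒y tD
      (C⊆D (Begins-init 2≤n C _ (yArc (2 + m) (s≤s z≤n) k<n ◅ ε) (∈-prefixesBefore⁻ 2≤n C P∈)))
      (≤-trans tD≤tC (Shared.y⇒≥ tC (∈-prefixesBefore⁻ 2≤n C P∈))))

    count-mono : BeginsIn C D (2 + m) → code (sharedPath D m k<n) ≤ code (sharedPath C m k<n) →
                 count 2≤n C (y (2 + m) k<n) ≤ count 2≤n D (y (2 + m) k<n)
    count-mono C⊆D tD≤tC = length-⊆ (prefixesBefore-unique 2≤n C (y (2 + m) k<n)) (y-⊆ C⊆D tD≤tC)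

    -- `D` gains at least its own shared prefix, which lies below that of `C` and does not continue
    -- by the nonslack edge there.
    count-strict : BeginsIn C D (2 + m) → code (sharedPath D m k<n) < code (sharedPath C m k<n) →
                   count 2≤n C (y (2 + m) k<n) < count 2≤n D (y (2 + m) k<n)
    count-strict C⊆D tD<tC = length-⊆ {xs = Shared.path tD ∷ prefixesBefore C (y (2 + m) k<n)}
      (¬Any⇒All¬ _ (λ tD∈ → <⇒≱ tD<tC (Shared.y⇒≥ tC (∈-prefixesBefore⁻ 2≤n C tD∈))) ∷
       prefixesBefore-unique 2≤n C (y (2 + m) k<n))
      λ { (here refl) → ∈-prefixesBefore⁺ 2≤n D (Shared.viaY tD) ; (there P∈) → y-⊆ C⊆D (<⇒≤ tD<tC) P∈ }

    extend-⊆ : BeginsIn C D (2 + m) → code (sharedPath D m k<n) ≡ code (sharedPath C m k<n) →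
               ∀ {h P} (a : Arc n (2 + m) h) → Begins 2≤n C (P ∷ʳ a) → Begins 2≤n D (P ∷ʳ a)
    extend-⊆ C⊆D eq {P = P} a Pa with outgoing inner k<n a
    ... | isX = Shared.≤⇒x tD (C⊆D (Begins-init 2≤n C P (a ◅ ε) Pa))
      (≤-trans (Shared.x⇒≤ tC Pa) (≤-reflexive (sym eq)))
    ... | isY = Shared.≥⇒y tD (C⊆D (Begins-init 2≤n C P (a ◅ ε) Pa))
      (≤-trans (≤-reflexive eq) (Shared.y⇒≥ tC Pa))

  -- Among cliques with the same prefixes at this vertex, the count of the nonslack edge is strictly
  -- antitone in the shared prefix.
  shared-≡ : ∀ (C D : MaximalClique n) {m} (k<n : 2 + m < n) → BeginsIn C D (2 + m) → BeginsIn D C (2 + m) →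
             count 2≤n C (y (2 + m) k<n) ≡ count 2≤n D (y (2 + m) k<n) →
             code (sharedPath C m k<n) ≡ code (sharedPath D m k<n)
  shared-≡ C D k<n C⊆D D⊆C eq = ≤-antisym
    (≮⇒≥ λ tD<tC → <-irrefl eq (count-strict C D k<n C⊆D tD<tC))
    (≮⇒≥ λ tC<tD → <-irrefl (sym eq) (count-strict D C k<n D⊆C tC<tD))

  AgreeBelow : (C D : MaximalClique n) → ℕ → Set
  AgreeBelow C D i = ∀ {j} (j<n : j < n) → j < i → count 2≤n C (y j j<n) ≡ count 2≤n D (y j j<n)

  AgreeBelow-sym : ∀ C D {i} → AgreeBelow C D i → AgreeBelow D C i
  AgreeBelow-sym C D agree j<n j<i = sym (agree j<n j<i)

  -- Induction on `k` through the last arc: at its source, equal prefixes and equal counts give the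
  -- same shared prefix, hence the same continuations.
  begins-agree : ∀ C D {i} → i ≤ n → AgreeBelow C D i → ∀ {k} → k ≤ i → BeginsIn C D k
  begins-agree C D {i} i≤n agree {k} k≤i = go C D k (<-wellFounded k) k≤i agree
    where
    -- Locating the shared prefix takes both inclusions at the smaller vertex, so the induction
    -- covers both orders of `C` and `D`.
    go : ∀ C D k → Acc _<_ k → k ≤ i → AgreeBelow C D i → BeginsIn C D k
    go C D k (acc rs) k≤i agree {P} bP with last P
    ... | nil = begins-ε 2≤n D
    ... | snoc P a = step a P bP
      where
      step : ∀ {h} (a : Arc n h k) (P : Path n 1 h) → Begins 2≤n C (P ∷ʳ a) → Begins 2≤n D (P ∷ʳ a)
      step {0} a P Pa with () ← path-≤ 2≤n P
      step {1} a P Pa with ε-unique 2≤n P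
      ... | refl = begins-first 2≤n D a
      step {suc (suc m)} a P Pa = extend-⊆ C D h<n C⊆D (shared-≡ D C h<n D⊆C C⊆D (sym (agree h<n h<i))) a Pa
        where
        h<k : 2 + m < k
        h<k = arc-< 2≤n a
        h<i = <-≤-trans h<k k≤i
        h<n = <-≤-trans h<i i≤n
        C⊆D = go C D (2 + m) (rs h<k) (<⇒≤ h<i) agree
        D⊆C = go D C (2 + m) (rs h<k) (<⇒≤ h<i) (AgreeBelow-sym C D agree)

  agree⇒⊆ : ∀ C D → AgreeBelow C D n → ∀ R → R ∈ᴿ routes C → R ∈ᴿ routes D
  -- A route is a prefix at `n` with an empty suffix.
  agree⇒⊆ C D agree R R∈C with begins-agree C D ≤-refl agree ≤-refl (ε , subst (_∈ᴿ routes C) (sym (◅◅-ε R)) R∈C)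
  ... | Q , ∈D rewrite ε-unique 2≤n Q = subst (_∈ᴿ routes D) (◅◅-ε R) ∈D

  count-injective : ∀ C D → AgreeBelow C D n → C ≈ D
  count-injective C D agree R = T-injective (agree⇒⊆ C D agree R)
    (agree⇒⊆ D C (AgreeBelow-sym C D agree) R)
    where
    T-injective : ∀ {b c} → (T b → T c) → (T c → T b) → b ≡ c
    T-injective {false} {false} _ _ = refl
    T-injective {false} {true}  _ g with () ← g _
    T-injective {true}  {false} f _ with () ← f _
    T-injective {true}  {true}  _ _ = refl

-- Exchanging one route

infix 4 _⊑_

_⊑_ : ∀ {n k} → Path n 1 k → Route n → Set
_⊑_ {n} {k} P T = Σ[ Q ∈ Path n k n ] P ◅◅ Q ≡ T

⊑-init : ∀ {n k h} {P : Path n 1 k} {a : Arc n k h} {T} → (P ∷ʳ a) ⊑ T → Σ[ Q ∈ Path n h n ] P ◅◅ a ◅ Q ≡ T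
⊑-init {P = P} {a} (Q , eq) = Q , trans (sym (∷ʳ-◅◅ P a Q)) eq

record Exchanged {n} (C D : MaximalClique n) (R S : Route n) : Set where
  constructor exchanged
  field
    R∈C  : R ∈ᴿ routes C
    R∉D  : R ∉ᴿ routes D
    S∈D  : S ∈ᴿ routes D
    S∉C  : S ∉ᴿ routes C
    same : ∀ T → T ≢ R → T ≢ S → routes C T ≡ routes D T

Exchanged-sym : ∀ {n} {C D : MaximalClique n} {R S} → Exchanged C D R S → Exchanged D C S R
Exchanged-sym (exchanged R∈C R∉D S∈D S∉C same) = exchanged S∈D S∉C R∈C R∉D λ T T≢S T≢R → sym (same T T≢R T≢S)

module _ {n : ℕ} (2≤n : 2 ≤ n) where

  -- The path visits `h`, and an arc starting before `h` and ending after it would jump over that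
  -- vertex.
  straddle : ∀ {i h v w m} (P : Path n i h) {Q : Path n h m} (A : Path n i v) {a : Arc n v w} {B : Path n w m} →
             v ≤ h → h < w → P ◅◅ Q ≡ A ◅◅ a ◅ B → v ≡ h
  straddle ε       A       v≤h h<w eq = ≤-antisym v≤h (path-≤ 2≤n A)
  straddle (b ◅ P) ε       v≤h h<w refl = contradiction (path-≤ 2≤n P) (<⇒≱ h<w)
  straddle (b ◅ P) (c ◅ A) v≤h h<w eq with ◅-injective eq
  ... | refl , _ , eq′ = straddle P A v≤h h<w eq′

  same-edge : ∀ {k h h′} (A A′ : Path n 1 k) {a : Arc n k h} {a′ : Arc n k h′} {B : Path n h n} {B′ : Path n h′ n} →
              A ◅◅ a ◅ B ≡ A′ ◅◅ a′ ◅ B′ → A ≡ A′ × Arc.edge a ≡ Arc.edge a′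
  same-edge A A′ eq with split-unique 2≤n A A′ eq
  ... | A≡A′ , eq′ with ◅-injective eq′
  ...   | refl , refl , _ = A≡A′ , refl

  -- A route passes `e` at most once, so `Ps` will be a singleton or empty; a list lets one counting
  -- identity cover both cases.
  Occurrences : (e : Edge n) (T : Route n) → List (Path n 1 (source e)) → Set
  Occurrences e T Ps = ∀ P → ((P ∷ʳ arrow e) ⊑ T → P ∈ Ps) × (P ∈ Ps → (P ∷ʳ arrow e) ⊑ T)

  occurs-at : ∀ {e T} A → (A ∷ʳ arrow e) ⊑ T → Occurrences e T [ A ]
  occurs-at {e} {T} A Ae P = only , λ { (here refl) → Ae }
    where
    only : (P ∷ʳ arrow e) ⊑ T → P ∈ [ A ]
    only Pe with ⊑-init {P = P} {arrow e} Pe | ⊑-init {P = A} {arrow e} Ae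
    ... | _ , eq | _ , eq′ = here (proj₁ (same-edge P A (trans eq (sym eq′))))

  -- The arc `a` either jumps over the source of `e` or leaves it by another edge.
  bypasses : ∀ {e T v w} (A : Path n 1 v) (a : Arc n v w) → (A ∷ʳ a) ⊑ T →
             v ≤ source e → source e < w → Arc.edge a ≢ e → Occurrences e T []
  bypasses {e} {T} A a Aa v≤ <w a≢e P = absurd , λ ()
    where
    absurd : (P ∷ʳ arrow e) ⊑ T → P ∈ []
    absurd Pe with ⊑-init {P = P} {arrow e} Pe | ⊑-init {P = A} {a} Aa
    ... | _ , eq | _ , eq′ with straddle P A v≤ <w (trans eq (sym eq′))
    ...   | refl = contradiction (proj₂ (same-edge A P (trans eq′ (sym eq)))) a≢e

  begins-other : ∀ {C D : MaximalClique n} {R S} → Exchanged C D R S → ∀ {k} {P : Path n 1 k} →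
                 Begins 2≤n C P → Begins 2≤n D P ⊎ P ⊑ R
  begins-other {R = R} {S} (exchanged _ _ _ S∉C same) {P = P} (Q , ∈C) with (P ◅◅ Q) ≟ᴾ R | (P ◅◅ Q) ≟ᴾ S
  ... | yes eq  | _        = inj₂ (Q , eq)
  ... | no PQ≢R | yes refl = contradiction ∈C S∉C
  ... | no PQ≢R | no PQ≢S  = inj₁ (Q , subst T (same _ PQ≢R PQ≢S) ∈C)

  ⊑⇒begins : ∀ {C : MaximalClique n} {R} → R ∈ᴿ routes C → ∀ {k} {P : Path n 1 k} → P ⊑ R → Begins 2≤n C P
  ⊑⇒begins R∈C (Q , refl) = Q , R∈C

  module _ {C D : MaximalClique n} {R S : Route n} (CD : Exchanged C D R S) where

    private
      DC : Exchanged D C S R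
      DC = Exchanged-sym CD

    -- Adding the prefixes lost with `S` to those of `C` gives the same set as adding the prefixes
    -- lost with `R` to those of `D`. The last two hypotheses exclude repetitions, so that lengths
    -- count elements.
    count-exchange : ∀ {e Ps Qs} → Occurrences e R Ps → Occurrences e S Qs → Unique Ps → Unique Qs →
      (∀ {P} → P ∈ Ps → ¬ Begins 2≤n D (P ∷ʳ arrow e)) →
      (∀ {P} → P ∈ Qs → ¬ Begins 2≤n C (P ∷ʳ arrow e)) →
      length Qs + count 2≤n C e ≡ length Ps + count 2≤n D e
    count-exchange {e} {Ps} {Qs} occR occS uPs uQs ¬D ¬C = begin
      length Qs + count 2≤n C e            ≡⟨ sym (length-++ Qs) ⟩
      length (Qs ++ prefixesBefore C e)    ≡⟨ length-≡
        (Uniqueₚ.++⁺ uQs (prefixesBefore-unique 2≤n C e) λ (P∈ , P∈C) → ¬C P∈ (∈-prefixesBefore⁻ 2≤n C P∈C))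
        (Uniqueₚ.++⁺ uPs (prefixesBefore-unique 2≤n D e) λ (P∈ , P∈D) → ¬D P∈ (∈-prefixesBefore⁻ 2≤n D P∈D))
        (into CD occR occS) (into DC occS occR) ⟩
      length (Ps ++ prefixesBefore D e)    ≡⟨ length-++ Ps ⟩
      length Ps + count 2≤n D e            ∎
      where
      open ≡-Reasoning
      into : ∀ {C D : MaximalClique n} {R S Ps Qs} → Exchanged C D R S → Occurrences e R Ps → Occurrences e S Qs →
             ∀ {P} → P ∈ Qs ++ prefixesBefore C e → P ∈ Ps ++ prefixesBefore D e
      into {C} {D} {R} {S} {Ps} {Qs} CD occR occS {P} P∈ with ∈-++⁻ Qs P∈
      ... | inj₁ P∈Qs = ∈-++⁺ʳ Ps (∈-prefixesBefore⁺ 2≤n D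
        (⊑⇒begins {D} (Exchanged.S∈D CD) (proj₂ (occS P) P∈Qs)))
      ... | inj₂ P∈C with begins-other CD {P = P ∷ʳ arrow e} (∈-prefixesBefore⁻ 2≤n C P∈C)
      ...   | inj₁ Pe∈D = ∈-++⁺ʳ Ps (∈-prefixesBefore⁺ 2≤n D Pe∈D)
      ...   | inj₂ Pe⊑R = ∈-++⁺ˡ (proj₁ (occR P) Pe⊑R)

    only-in-first : ∀ {k} {P : Path n 1 k} → Begins 2≤n C P → ¬ Begins 2≤n D P → P ⊑ R
    only-in-first P∈C P∉D with begins-other CD P∈C
    ... | inj₁ P∈D = contradiction P∈D P∉D
    ... | inj₂ P⊑R = P⊑R

    -- `r` and `s` occupy the same gap among the prefixes common to `C` and `D`. This is demanded
    -- only at `v < n`, where codes represent the prefix order.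
    Aligned : ∀ {v} → Path n 1 v → Path n 1 v → Set
    Aligned {v} r s = v < n → ∀ (t : Path n 1 v) → Begins 2≤n C t → Begins 2≤n D t →
      (code t < code r × code t < code s) ⊎ (code r < code t × code s < code t)

    -- A common prefix entering `w` by another arc than `a` compares with both extensions alike; one
    -- entering by `a` reduces to the alignment at `v`.
    Aligned-∷ʳ : ∀ {v w} (r s : Path n 1 v) (a : Arc n v w) → Aligned r s → Aligned (r ∷ʳ a) (s ∷ʳ a)
    Aligned-∷ʳ r s a aligned w<n t t∈C t∈D with last t
    ... | nil      = contradiction r (no-return 2≤n a)
    ... | snoc t b with incoming w<n b a
    ...   | less b≺a    = inj₁ (≺ⁱⁿ⇒< 2≤n {a = b} {a} b≺a t r , ≺ⁱⁿ⇒< 2≤n {a = b} {a} b≺a t s)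
    ...   | greater a≺b = inj₂ (≺ⁱⁿ⇒< 2≤n {a = a} {b} a≺b r t , ≺ⁱⁿ⇒< 2≤n {a = a} {b} a≺b s t)
    ...   | equal with aligned (<-trans (arc-< 2≤n a) w<n) t
                       (Begins-init 2≤n C t (a ◅ ε) t∈C) (Begins-init 2≤n D t (a ◅ ε) t∈D)
    ...     | inj₁ (t<r , t<s) = inj₁ (◅◅-monoˡ-< {P = t} {r} (a ◅ ε) t<r , ◅◅-monoˡ-< {P = t} {s} (a ◅ ε) t<s)
    ...     | inj₂ (r<t , s<t) = inj₂ (◅◅-monoˡ-< {P = r} {t} (a ◅ ε) r<t , ◅◅-monoˡ-< {P = s} {t} (a ◅ ε) s<t)

    -- Otherwise the position of the prefix t, which is shared by both edges,
    -- relative to r and s yields a conflict in C or in D.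
    no-divergence : ∀ {v h h′} (r s : Path n 1 v) (a : Arc n v h) (b : Arc n v h′) → v < n →
      Arc.edge a ≺ᵒᵘᵗ Arc.edge b ⊎ Arc.edge b ≺ᵒᵘᵗ Arc.edge a →
      (r ∷ʳ a) ⊑ R → (s ∷ʳ b) ⊑ S → ¬ Begins 2≤n D r → Aligned r s →
      ∀ t → Begins 2≤n C (t ∷ʳ a) → ¬ Begins 2≤n C (t ∷ʳ b)
    no-divergence r s a b v<n a≶b ra⊑R sb⊑S r∉D aligned t ta∈C tb∈C =
      crossing a≶b (aligned v<n t (Begins-init 2≤n C t (a ◅ ε) ta∈C) t∈D)
      where
      ra∈C : Begins 2≤n C (r ∷ʳ a)
      ra∈C = ⊑⇒begins {C} (Exchanged.R∈C CD) ra⊑R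
      sb∈D : Begins 2≤n D (s ∷ʳ b)
      sb∈D = ⊑⇒begins {D} (Exchanged.S∈D CD) sb⊑S
      a≢b : Arc.edge a ≢ Arc.edge b
      a≢b eq = distinct a≶b eq
        where
        distinct : ∀ {e f : Edge n} → e ≺ᵒᵘᵗ f ⊎ f ≺ᵒᵘᵗ e → e ≢ f
        distinct (inj₁ x≺y) ()
        distinct (inj₂ x≺y) ()
      -- Both continuations of `t` survive in `D`: the one by `b` since `R` leaves `v` by `a`, the
      -- one by `a` since `R` reaches `v` by `r`, which differs from `t` as `r` is not in `D`.
      tb∈D : Begins 2≤n D (t ∷ʳ b)
      tb∈D with begins-other CD tb∈C
      ... | inj₁ tb∈D = tb∈D
      ... | inj₂ tb⊑R with ⊑-init {P = t} {b} tb⊑R | ⊑-init {P = r} {a} ra⊑R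
      ...   | _ , eq | _ , eq′ = contradiction (proj₂ (same-edge r t (trans eq′ (sym eq)))) a≢b
      t∈D : Begins 2≤n D t
      t∈D = Begins-init 2≤n D t (b ◅ ε) tb∈D
      ta∈D : Begins 2≤n D (t ∷ʳ a)
      ta∈D with begins-other CD ta∈C
      ... | inj₁ ta∈D = ta∈D
      ... | inj₂ ta⊑R with ⊑-init {P = t} {a} ta⊑R | ⊑-init {P = r} {a} ra⊑R
      ...   | _ , eq | _ , eq′ =
        contradiction (subst (Begins 2≤n D) (proj₁ (same-edge t r (trans eq (sym eq′)))) t∈D) r∉D
      crossing : Arc.edge a ≺ᵒᵘᵗ Arc.edge b ⊎ Arc.edge b ≺ᵒᵘᵗ Arc.edge a →
                 ¬ ((code t < code r × code t < code s) ⊎ (code r < code t × code s < code t))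
      crossing (inj₁ a≺b) (inj₁ (t<r , _)) = noncrossing 2≤n C {P = t} {r} {b} {a} t<r a≺b tb∈C ra∈C
      crossing (inj₂ b≺a) (inj₁ (_ , t<s)) = noncrossing 2≤n D {P = t} {s} {a} {b} t<s b≺a ta∈D sb∈D
      crossing (inj₁ a≺b) (inj₂ (_ , s<t)) = noncrossing 2≤n D {P = s} {t} {b} {a} s<t a≺b sb∈D ta∈D
      crossing (inj₂ b≺a) (inj₂ (r<t , _)) = noncrossing 2≤n C {P = r} {t} {a} {b} r<t b≺a ra∈C tb∈C

    -- By `no-divergence` both routes take the same edge at every inner vertex they reach from `v`
    -- on, so each such nonslack edge is passed by both or by neither.
    parallel : ∀ {v} → 2 ≤ v → (r s : Path n 1 v) (Q Q′ : Path n v n) → r ◅◅ Q ≡ R → s ◅◅ Q′ ≡ S →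
               ¬ Begins 2≤n D r → ¬ Begins 2≤n C s → Aligned r s →
               ∀ {j} (j<n : j < n) → v ≤ j → count 2≤n C (y j j<n) ≡ count 2≤n D (y j j<n)
    parallel _ r s ε       _ _ _ _ _ _ j<n v≤j = contradiction v≤j (<⇒≱ j<n)
    parallel _ r s (a ◅ _) ε _ _ _ _ _ j<n v≤j = contradiction v≤j (<⇒≱ j<n)
    parallel {suc (suc m)} (s≤s (s≤s z≤n)) r s (a ◅ Q) (b ◅ Q′) rQ≡R sQ′≡S r∉D s∉C aligned {j} j<n v≤j =
      continue (outgoing (s≤s (s≤s z≤n)) v<n a) (outgoing (s≤s (s≤s z≤n)) v<n b)
        Q Q′ rQ≡R sQ′≡S (m≤n⇒m<n∨m≡n v≤j)
      where
      v<n : 2 + m < n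
      v<n = ≤-<-trans v≤j j<n
      t = shared 2≤n C (2 + m) (s≤s (s≤s z≤n)) v<n
      source-y : 1 ⊔ j ≡ j
      source-y = m≤n⇒m⊔n≡n (≤-trans (s≤s z≤n) v≤j)
      next∉ : ∀ {h} (c : Arc n (2 + m) h) → ¬ Begins 2≤n D (r ∷ʳ c) × ¬ Begins 2≤n C (s ∷ʳ c)
      next∉ c = r∉D ∘ Begins-init 2≤n D r (c ◅ ε) , s∉C ∘ Begins-init 2≤n C s (c ◅ ε)
      continue : ∀ {h h′} {a : Arc n (2 + m) h} {b : Arc n (2 + m) h′} →
        Outgoing (s≤s z≤n) v<n a → Outgoing (s≤s z≤n) v<n b → (Q : Path n h n) (Q′ : Path n h′ n) →
        r ◅◅ a ◅ Q ≡ R → s ◅◅ b ◅ Q′ ≡ S → 2 + m < j ⊎ 2 + m ≡ j →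
        count 2≤n C (y j j<n) ≡ count 2≤n D (y j j<n)
      continue {a = a} {b} isX isY Q Q′ eq eq′ _ = contradiction (Shared.viaY t)
        (no-divergence r s a b v<n (inj₁ x≺y) (Q , trans (∷ʳ-◅◅ r a Q) eq)
          (Q′ , trans (∷ʳ-◅◅ s b Q′) eq′) r∉D aligned _ (Shared.viaX t))
      continue {a = a} {b} isY isX Q Q′ eq eq′ _ = contradiction (Shared.viaX t)
        (no-divergence r s a b v<n (inj₂ x≺y) (Q , trans (∷ʳ-◅◅ r a Q) eq)
          (Q′ , trans (∷ʳ-◅◅ s b Q′) eq′) r∉D aligned _ (Shared.viaY t))
      continue {a = a} isX isX Q Q′ eq eq′ (inj₂ refl) = count-exchange
        (bypasses r a (Q , trans (∷ʳ-◅◅ r a Q) eq) ≤-refl ≤-refl λ ())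
        (bypasses s a (Q′ , trans (∷ʳ-◅◅ s a Q′) eq′) ≤-refl ≤-refl λ ()) [] [] (λ ()) (λ ())
      continue {a = a} isY isY Q Q′ eq eq′ (inj₂ refl) = suc-injective (count-exchange
        (occurs-at r (Q , trans (∷ʳ-◅◅ r a Q) eq)) (occurs-at s (Q′ , trans (∷ʳ-◅◅ s a Q′) eq′))
        (All.[] ∷ []) (All.[] ∷ [])
        (λ { (here refl) → proj₁ (next∉ a) }) (λ { (here refl) → proj₂ (next∉ a) }))
      continue {a = a} isX isX Q Q′ eq eq′ (inj₁ v<j) =
        parallel (s≤s (s≤s z≤n)) (r ∷ʳ a) (s ∷ʳ a) Q Q′
          (trans (∷ʳ-◅◅ r a Q) eq) (trans (∷ʳ-◅◅ s a Q′) eq′)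
          (proj₁ (next∉ a)) (proj₂ (next∉ a)) (Aligned-∷ʳ r s a aligned) j<n v<j
      continue {h} {a = a} isY isY Q Q′ eq eq′ (inj₁ v<j) with h ≤? j
      ... | yes h≤j = parallel (⊓-glb (s≤s (s≤s z≤n)) 2≤n) (r ∷ʳ a) (s ∷ʳ a) Q Q′
          (trans (∷ʳ-◅◅ r a Q) eq) (trans (∷ʳ-◅◅ s a Q′) eq′)
          (proj₁ (next∉ a)) (proj₂ (next∉ a)) (Aligned-∷ʳ r s a aligned) j<n h≤j
      -- The common nonslack edge jumps over `j`, so neither route passes `y j`.
      ... | no h≰j = count-exchange
        (bypasses r a (Q , trans (∷ʳ-◅◅ r a Q) eq) v≤source source<h λ { refl → <-irrefl refl v<j })
        (bypasses s a (Q′ , trans (∷ʳ-◅◅ s a Q′) eq′) v≤source source<h λ { refl → <-irrefl refl v<j })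
        [] [] (λ ()) (λ ())
        where
        v≤source = subst (2 + m ≤_) (sym source-y) v≤j
        source<h = subst (_< h) (sym source-y) (≰⇒> h≰j)

-- The detour between the exchanged routes

module Departure {n : ℕ} (2≤n : 2 ≤ n) {C D : MaximalClique n} {R S : Route n} (CD : Exchanged C D R S)
         {m} (k<n : 2 + m < n) (agree : AgreeBelow 2≤n C D (2 + m))
         (differ : count 2≤n D (y (2 + m) k<n) < count 2≤n C (y (2 + m) k<n)) where

  private
    DC : Exchanged D C S R
    DC = Exchanged-sym CD

    k≤n = <⇒≤ k<n

    C⊆D : BeginsIn 2≤n C D (2 + m)
    C⊆D = begins-agree 2≤n C D k≤n agree ≤-refl
    D⊆C : BeginsIn 2≤n D C (2 + m)
    D⊆C = begins-agree 2≤n D C k≤n (AgreeBelow-sym 2≤n C D agree) ≤-refl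

    module tC = Shared (shared 2≤n C (2 + m) (s≤s (s≤s z≤n)) k<n)
    module tD = Shared (shared 2≤n D (2 + m) (s≤s (s≤s z≤n)) k<n)

    -- Both cliques have the same prefixes at `2 + m`, so the larger nonslack count of `C` means a
    -- lower shared prefix.
    tC<tD : code tC.path < code tD.path
    tC<tD = ≰⇒> λ tD≤tC → <⇒≱ differ (count-mono 2≤n C D k<n C⊆D tD≤tC)

    xₖ = xArc {n} (2 + m) (s≤s z≤n) k<n
    yₖ = yArc {n} (2 + m) (s≤s z≤n) k<n

    -- The shared prefix of `C` lies below the cut of `D`, so its nonslack continuation is missing
    -- from `D` and must lie on `R`; likewise the slack continuation of the shared prefix of `D`
    -- lies on `S`.
    r₀∉D : ¬ Begins 2≤n D (tC.path ∷ʳ yₖ)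
    r₀∉D r₀∈D = <⇒≱ tC<tD (tD.y⇒≥ r₀∈D)
    r₀⊑R : (tC.path ∷ʳ yₖ) ⊑ R
    r₀⊑R = only-in-first 2≤n CD tC.viaY r₀∉D

    s₁ : Path n 1 (3 + m)
    s₁ = tD.path ∷ʳ xₖ
    s₁∉C : ¬ Begins 2≤n C s₁
    s₁∉C s₁∈C = <⇒≱ tC<tD (tC.x⇒≤ s₁∈C)
    s₁⊑S : s₁ ⊑ S
    s₁⊑S = only-in-first 2≤n DC tD.viaX s₁∉C

  -- At `2 + m`, `R` takes the nonslack edge and `S` the slack edge, which accounts for a difference
  -- of exactly one.
  count-at : count 2≤n C (y (2 + m) k<n) ≡ suc (count 2≤n D (y (2 + m) k<n))
  count-at = count-exchange 2≤n CD (occurs-at 2≤n tC.path r₀⊑R) (bypasses 2≤n tD.path xₖ s₁⊑S ≤-refl ≤-refl λ ())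
    (All.[] ∷ []) [] (λ { (here refl) → r₀∉D }) (λ ())

  module _ (3+m<n : 3 + m < n) where

    private
      y₁ = yArc {n} (3 + m) (s≤s z≤n) 3+m<n

      -- Ending in a slack edge beats ending in a nonslack one, and `tD.path` is the greatest prefix
      -- that `D` continues by the slack edge.
      s₁-greatest : ∀ (Z : Path n 1 (3 + m)) → Begins 2≤n D Z → code Z ≤ code s₁
      s₁-greatest Z Z∈D with last Z
      ... | snoc Z a with incoming 3+m<n a xₖ
      ...   | less a≺x = <⇒≤ (≺ⁱⁿ⇒< 2≤n {a = a} {xₖ} a≺x Z tD.path)
      ...   | equal    = ◅◅-monoˡ-≤ {P = Z} {tD.path} (xₖ ◅ ε) (tD.x⇒≤ Z∈D)

      s₂∉C : ¬ Begins 2≤n C (s₁ ∷ʳ y₁)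
      s₂∉C = s₁∉C ∘ Begins-init 2≤n C s₁ (y₁ ◅ ε)

      -- Being greatest, `s₁` is not below the shared prefix of `D`, so `D` continues it by the
      -- nonslack edge; as this is not in `C`, it lies on `S`.
      s₂⊑S : (s₁ ∷ʳ y₁) ⊑ S
      s₂⊑S = only-in-first 2≤n DC (≥⇒y tD.viaX (s₁-greatest path initial)) s₂∉C
        where open Shared (shared 2≤n D (3 + m) (s≤s (s≤s z≤n)) 3+m<n)

    -- `R` jumps over `3 + m`, while `S` takes the nonslack edge leaving it.
    count-next : suc (count 2≤n C (y (3 + m) 3+m<n)) ≡ count 2≤n D (y (3 + m) 3+m<n)
    count-next = count-exchange 2≤n CD
      (bypasses 2≤n tC.path yₖ r₀⊑R (n≤1+n _) (⊓-glb ≤-refl 3+m<n) (λ ())) (occurs-at 2≤n s₁ s₂⊑S)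
      [] (All.[] ∷ []) (λ ()) (λ { (here refl) → s₂∉C })

    module _ (4+m<n : 4 + m < n) where

      private
        -- The arcs yₖ and y₁, where the minimum in the target has been evaluated.
        yᵣ : Arc n (2 + m) (4 + m)
        yᵣ = arc (y (2 + m) k<n) refl (m≤n⇒m⊓n≡m 3+m<n)
        yₛ : Arc n (3 + m) (5 + m)
        yₛ = arc (y (3 + m) 3+m<n) refl (m≤n⇒m⊓n≡m 4+m<n)
        x₂ = xArc {n} (4 + m) (s≤s z≤n) 4+m<n

        r₁ : Path n 1 (4 + m)
        r₁ = tC.path ∷ʳ yᵣ

      r₁∈C : Begins 2≤n C r₁
      r₁∈C = from-arrow 2≤n C (y (2 + m) k<n) (ends yᵣ) tC.path tC.viaY
      r₁∉D : ¬ Begins 2≤n D r₁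
      r₁∉D r₁∈D = r₀∉D (to-arrow 2≤n D (y (2 + m) k<n) (ends yᵣ) tC.path r₁∈D)

      -- Dually to `s₁-greatest`, a nonslack last edge is the lesser one, and `tC.path` is the least
      -- prefix that `C` continues by it. Hence `R` takes the slack edge next.
      r₁-least : ∀ (Z : Path n 1 (4 + m)) → Begins 2≤n C Z → code r₁ ≤ code Z
      r₁-least Z Z∈C with last Z
      ... | snoc Z a with incoming 4+m<n yᵣ a
      ...   | less y≺a = <⇒≤ (≺ⁱⁿ⇒< 2≤n {a = yᵣ} {a} y≺a tC.path Z)
      ...   | equal    = ◅◅-monoˡ-≤ {P = tC.path} {Z} (yᵣ ◅ ε)
        (tC.y⇒≥ (to-arrow 2≤n C (y (2 + m) k<n) (ends yᵣ) Z Z∈C))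

      r s : Path n 1 (5 + m)
      r = r₁ ∷ʳ x₂
      s = s₁ ∷ʳ yₛ

      r∉D : ¬ Begins 2≤n D r
      r∉D = r₁∉D ∘ Begins-init 2≤n D r₁ (x₂ ◅ ε)
      s∉C : ¬ Begins 2≤n C s
      s∉C = s₁∉C ∘ Begins-init 2≤n C s₁ (yₛ ◅ ε)
      r⊑R : r ⊑ R
      r⊑R = only-in-first 2≤n CD (≤⇒x r₁∈C (r₁-least path initial)) r∉D
        where open Shared (shared 2≤n C (4 + m) (s≤s (s≤s z≤n)) 4+m<n)
      s⊑S : s ⊑ S
      s⊑S = only-in-first 2≤n DC (from-arrow 2≤n D (y (3 + m) 3+m<n) (ends yₛ) s₁
        (⊑⇒begins 2≤n {D} (Exchanged.S∈D CD) s₂⊑S)) s∉C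

      -- A common prefix entering by the slack edge is above `s`, and above `r` because `r₁` is
      -- least in `C` and missing from `D`. One entering by the nonslack edge is below `r`, and
      -- below `s` because `s₁` is greatest in `D` and missing from `C`.
      aligned : Aligned 2≤n CD r s
      aligned 5+m<n Z Z∈C Z∈D with last Z
      ... | snoc Z a with incoming 5+m<n a x₂
      ...   | equal = inj₂ (◅◅-monoˡ-< {P = r₁} {Z} (x₂ ◅ ε)
                              (≤∧≢⇒< (r₁-least Z (Begins-init 2≤n C Z (x₂ ◅ ε) Z∈C)) r₁≢Z) ,
                            ≺ⁱⁿ⇒< 2≤n {a = yₛ} {x₂} y≺x s₁ Z)
        where
        r₁≢Z : code r₁ ≢ code Z
        r₁≢Z eq = r₁∉D (subst (Begins 2≤n D) (sym (code-injective 2≤n 4+m<n eq))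
          (Begins-init 2≤n D Z (x₂ ◅ ε) Z∈D))
      ...   | less a≺x with incoming 5+m<n a yₛ
      ...     | equal = inj₁ (≺ⁱⁿ⇒< 2≤n {a = yₛ} {x₂} y≺x Z r₁ ,
                              ◅◅-monoˡ-< {P = Z} {s₁} (yₛ ◅ ε)
                                (≤∧≢⇒< (s₁-greatest Z (Begins-init 2≤n D Z (yₛ ◅ ε) Z∈D)) Z≢s₁))
        where
        Z≢s₁ : code Z ≢ code s₁
        Z≢s₁ eq = s₁∉C (subst (Begins 2≤n C) (code-injective 2≤n 3+m<n eq) (Begins-init 2≤n C Z (yₛ ◅ ε) Z∈C))
      ...     | greater y≺a with y≺a | a≺x
      ...       | y≺x | ()

      count-after : ∀ {j} (j<n : j < n) → 4 + m ≤ j → count 2≤n C (y j j<n) ≡ count 2≤n D (y j j<n)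
      count-after j<n 4+m≤j with m≤n⇒m<n∨m≡n 4+m≤j
      -- `S` jumps over `4 + m`, and `R` leaves it by the slack edge; the routes meet again at
      -- `5 + m`.
      ... | inj₂ refl = count-exchange 2≤n CD
        (bypasses 2≤n r₁ x₂ r⊑R ≤-refl ≤-refl λ ()) (bypasses 2≤n s₁ yₛ s⊑S (n≤1+n _) ≤-refl λ ())
        [] [] (λ ()) (λ ())
      ... | inj₁ 5+m≤j = parallel 2≤n CD (s≤s (s≤s z≤n)) r s (proj₁ r⊑R) (proj₁ s⊑S) (proj₂ r⊑R) (proj₂ s⊑S)
        r∉D s∉C aligned j<n 5+m≤j

-- Flows and elementary moves

-- Duplicate-free lists with the same elements are permutations of each other; this replaces the
-- filtered edge lists at a vertex by explicit ones.
sum-filter : ∀ {n} {P : Edge n → Set} (P? : Decidable P) (f : Edge n → ℕ) (es : List (Edge n)) →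
             Unique es → (∀ {e} → P e → e ∈ es) → (∀ {e} → e ∈ es → P e) →
             sum (map f (filter P? (edges n))) ≡ sum (map f es)
sum-filter P? f es unique complete sound = sum-↭ (map⁺ f (∼bag⇒↭ (unique∧set⇒bag
  (Uniqueₚ.filter⁺ P? (edges-unique _)) unique
  (mk⇔ (complete ∘ proj₂ ∘ ∈-filter⁻ P? {xs = edges _}) (λ e∈ → ∈-filter⁺ P? (edges-complete _) (sound e∈))))))

-- Conservation amounts to f(xᵢ) = (i - 1) - f(yᵢ₋₁) - f(yᵢ), so that a flow f is
-- determined by its values Y on the nonslack edges.
record Valid (n : ℕ) (Y : ℕ → ℕ) : Set where
  field
    at-0  : Y 0 ≡ 0
    at-1  : Y 1 ≡ 0
    bound : ∀ i → suc i < n → Y i + Y (suc i) ≤ i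

flowValue : ∀ {n} → (ℕ → ℕ) → Edge n → ℕ
-- A default value: slack edges have index at least 1.
flowValue Y (x zero    _ _) = 0
flowValue Y (x (suc i) _ _) = i ∸ (Y i + Y (suc i))
flowValue Y (y i _)         = Y i

≡ᵇ-refl : ∀ n → (n ≡ᵇ n) ≡ true
≡ᵇ-refl n = Equivalence.to T-≡ (≡⇒≡ᵇ n n refl)

≢⇒≡ᵇ : ∀ {m n} → m ≢ n → (m ≡ᵇ n) ≡ false
≢⇒≡ᵇ {m} {n} m≢n = ¬-not λ eq → m≢n (≡ᵇ⇒≡ m n (Equivalence.from T-≡ eq))

δ-refl : ∀ i → δ i i ≡ 1ℤ
δ-refl i rewrite ≡ᵇ-refl i = refl

δ-≢ : ∀ {i j} → i ≢ j → δ i j ≡ 0ℤ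
δ-≢ i≢j rewrite ≢⇒≡ᵇ i≢j = refl

partialSum : (ℕ → ℤ) → ℕ → ℤ
partialSum f zero    = f 0
partialSum f (suc k) = partialSum f k ℤ.+ f (suc k)

partialSum-cong : ∀ {f g} k → (∀ j → j ≤ k → f j ≡ g j) → partialSum f k ≡ partialSum g k
partialSum-cong zero    f≗g = f≗g 0 z≤n
partialSum-cong (suc k) f≗g =
  cong₂ ℤ._+_ (partialSum-cong k λ j j≤k → f≗g j (m≤n⇒m≤1+n j≤k)) (f≗g (suc k) ≤-refl)

partialSum-0 : ∀ {f} k → (∀ j → j ≤ k → f j ≡ 0ℤ) → partialSum f k ≡ 0ℤ
partialSum-0 zero    f≗0 = f≗0 0 z≤n
partialSum-0 (suc k) f≗0 rewrite partialSum-0 k (λ j j≤k → f≗0 j (m≤n⇒m≤1+n j≤k)) | f≗0 (suc k) ≤-refl = refl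

partialSum-injective : ∀ {f g} k → (∀ j → j ≤ k → partialSum f j ≡ partialSum g j) → f k ≡ g k
partialSum-injective zero    eq = eq 0 z≤n
partialSum-injective {f} {g} (suc k) eq = ∙-cancelˡ (AbelianGroup.group ℤ.+-0-abelianGroup) (partialSum f k) _ _ (begin
  partialSum f k ℤ.+ f (suc k) ≡⟨ eq (suc k) ≤-refl ⟩
  partialSum g k ℤ.+ g (suc k) ≡⟨ cong (ℤ._+ g (suc k)) (sym (eq k (n≤1+n k))) ⟩
  partialSum f k ℤ.+ g (suc k) ∎)
  where open ≡-Reasoning

-- The change made by a move telescopes, so that it affects a single partial sum.
partialSum-change : ∀ {f g i} k → (∀ j → j ≤ k → g j ≡ f j ℤ.+ (δ j i ℤ.- δ j (suc i))) →
                    partialSum g k ≡ partialSum f k ℤ.+ δ k i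
partialSum-change {f} {g} {i} zero    eq = trans (eq 0 z≤n) (cong (λ z → f 0 ℤ.+ z) (ℤ.+-identityʳ (δ 0 i)))
partialSum-change {f} {g} {i} (suc k) eq = trans
  (cong₂ ℤ._+_ (partialSum-change k λ j j≤k → eq j (m≤n⇒m≤1+n j≤k)) (eq (suc k) ≤-refl))
  (telescope (partialSum f k) (δ k i) (f (suc k)) (δ (suc k) i))
  where
  telescope : ∀ a b c d → (a ℤ.+ b) ℤ.+ (c ℤ.+ (d ℤ.- b)) ≡ (a ℤ.+ c) ℤ.+ d
  telescope = ℤ.solve-∀

nonslackValues : ∀ {n} → (Edge n → ℤ) → ℕ → ℤ
nonslackValues {n} h j with j <? n
... | yes j<n = h (y j j<n)
... | no  _   = 0ℤ

nonslackValues-< : ∀ {n} (h : Edge n → ℤ) {j} (j<n : j < n) → nonslackValues h j ≡ h (y j j<n)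
nonslackValues-< {n} h {j} j<n with j <? n
... | yes _   = refl
... | no j≮n = contradiction j<n j≮n

-- Starting the sum at index 0 is harmless, as `φ C` vanishes on `y 0` and `y 1`, which leave vertex
-- 1.
coordinate : ∀ {n} → (Edge n → ℤ) → ℕ → ℤ
coordinate h = partialSum (nonslackValues h)

coordinate-change : ∀ {n} {f g : Edge n → ℤ} {i k} → k < n →
                    (∀ {j} (j<n : j < n) → g (y j j<n) ≡ f (y j j<n) ℤ.+ change i (y j j<n)) →
                    coordinate g k ≡ coordinate f k ℤ.+ δ k i
coordinate-change {f = f} {g} {i} {k} k<n eq = partialSum-change k λ j j≤k →
  let j<n = ≤-<-trans j≤k k<n in
  trans (nonslackValues-< g j<n) (trans (eq j<n) (cong (ℤ._+ change i (y j j<n)) (sym (nonslackValues-< f j<n))))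

-- The factor `-1` is kept as a product to match `s ◃ 1` for the negative sign.
+-reverse : ∀ a b c → a ≡ b ℤ.+ c → b ≡ a ℤ.+ ℤ.-1ℤ ℤ.* c
+-reverse _ b c refl = ring b c
  where
  ring : ∀ b c → b ≡ b ℤ.+ c ℤ.+ ℤ.-1ℤ ℤ.* c
  ring = ℤ.solve-∀

coordinate-move : ∀ {n i s} {f g : Flow n} {k} → k < n → Move i f g s →
  coordinate (+_ ∘ value g) k ≡ coordinate (+_ ∘ value f) k ℤ.+ (s ◃ 1) ℤ.* δ k i
coordinate-move {i = i} {f = f} {g} {k} k<n (m⁺ _ _ eq) = trans
  (coordinate-change k<n λ j<n → eq (y _ j<n))
  (cong (λ z → coordinate (+_ ∘ value f) k ℤ.+ z) (sym (ℤ.*-identityˡ (δ k i))))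
coordinate-move {i = i} {f = f} {g} {k} k<n (m⁻ _ _ eq) = +-reverse (coordinate (+_ ∘ value f) k) _ (δ k i)
  (coordinate-change k<n λ j<n → add-change {c = change i (y _ j<n)} (eq (y _ j<n)))
  where
  add-change : ∀ {a b c} → a ≡ b ℤ.- c → b ≡ a ℤ.+ c
  add-change {_} {b} {c} refl = ring b c
    where
    ring : ∀ b c → b ≡ b ℤ.- c ℤ.+ c
    ring = ℤ.solve-∀

lookup-±e : ∀ {d} s (i k : Fin d) → lookup (±e s i) k ≡ (s ◃ 1) ℤ.* δ (toℕ k) (toℕ i)
lookup-±e s zero    zero    = sym (ℤ.*-identityʳ (s ◃ 1))
lookup-±e s zero    (suc k) = trans (lookup-replicate k 0ℤ) (sym (ℤ.*-zeroʳ (s ◃ 1)))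
lookup-±e s (suc i) zero    = sym (ℤ.*-zeroʳ (s ◃ 1))
lookup-±e s (suc i) (suc k) = lookup-±e s i k

sumTo : (ℕ → ℕ) → ℕ → ℕ
sumTo f zero    = f 0
sumTo f (suc k) = sumTo f k + f (suc k)

sumTo-mono-≤ : ∀ {f g} k → (∀ j → j ≤ k → f j ≤ g j) → sumTo f k ≤ sumTo g k
sumTo-mono-≤ zero    f≤g = f≤g 0 z≤n
sumTo-mono-≤ (suc k) f≤g = +-mono-≤ (sumTo-mono-≤ k λ j j≤k → f≤g j (m≤n⇒m≤1+n j≤k)) (f≤g (suc k) ≤-refl)

sumTo-mono-< : ∀ {f g i} k → i ≤ k → (∀ j → j ≤ k → f j ≤ g j) → f i < g i → sumTo f k < sumTo g k
sumTo-mono-< {i = zero} zero    _   _   f<g = f<g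
sumTo-mono-< {i = i}    (suc k) i≤k f≤g f<g with m≤n⇒m<n∨m≡n i≤k
... | inj₁ (s≤s i≤k) = +-mono-<-≤ (sumTo-mono-< k i≤k (λ j j≤k → f≤g j (m≤n⇒m≤1+n j≤k)) f<g) (f≤g (suc k) ≤-refl)
... | inj₂ refl       = +-mono-≤-< (sumTo-mono-≤ k λ j j≤k → f≤g j (m≤n⇒m≤1+n j≤k)) f<g

ι : ℕ → ℕ → ℕ
ι i j = if i ≡ᵇ j then 1 else 0

ι-refl : ∀ i → ι i i ≡ 1
ι-refl i rewrite ≡ᵇ-refl i = refl

ι-≢ : ∀ {i j} → i ≢ j → ι i j ≡ 0
ι-≢ i≢j rewrite ≢⇒≡ᵇ i≢j = refl

+ι≡δ : ∀ i j → + ι i j ≡ δ i j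
+ι≡δ i j with i ≡ᵇ j
... | true  = refl
... | false = refl

private
  δ-unchanged : ∀ (a b : ℕ) {d e} → d ≡ 0ℤ → e ≡ 0ℤ → a ≡ b → + a ≡ + b ℤ.+ (d ℤ.- e)
  δ-unchanged a b refl refl refl = sym (ℤ.+-identityʳ (+ b))

  δ-increased : ∀ (a b : ℕ) {d e} → d ≡ 1ℤ → e ≡ 0ℤ → a ≡ suc b → + a ≡ + b ℤ.+ (d ℤ.- e)
  δ-increased a b refl refl refl = cong +_ (+-comm 1 b)

  δ-decreased : ∀ (a b : ℕ) {d e} → d ≡ 0ℤ → e ≡ 1ℤ → suc a ≡ b → + a ≡ + b ℤ.+ (d ℤ.- e)
  δ-decreased a b refl refl refl = refl

module _ {n : ℕ} (2≤n : 2 ≤ n) {C D : MaximalClique n} {R S : Route n} (CD : Exchanged C D R S)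
         {m} (k<n : 2 + m < n) (agree : AgreeBelow 2≤n C D (2 + m))
         (differ : count 2≤n D (y (2 + m) k<n) < count 2≤n C (y (2 + m) k<n)) where

  -- Below `2 + m` the counts agree by assumption; from there on `R` and `S` pass the same nonslack
  -- edges, except for `y (2 + m)` on `R` and `y (3 + m)` on `S`.
  count-change : ∀ {j} (j<n : j < n) →
    + count 2≤n C (y j j<n) ≡ + count 2≤n D (y j j<n) ℤ.+ change (2 + m) (y {n} j j<n)
  count-change {j} j<n with <-cmp j (2 + m)
  ... | tri< j<k j≢k _ = δ-unchanged (count 2≤n C (y j j<n)) (count 2≤n D (y j j<n))
    (δ-≢ j≢k) (δ-≢ (<⇒≢ (m<n⇒m<1+n j<k))) (agree j<n j<k)
  ... | tri≈ _ refl _  = δ-increased (count 2≤n C (y j j<n)) (count 2≤n D (y j j<n))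
    (δ-refl m) (δ-≢ (<⇒≢ (n<1+n m))) (Departure.count-at 2≤n CD k<n agree differ)
  ... | tri> _ j≢k k<j with m≤n⇒m<n∨m≡n k<j
  ...   | inj₂ refl  = δ-decreased (count 2≤n C (y j j<n)) (count 2≤n D (y j j<n))
    (δ-≢ j≢k) (δ-refl m) (Departure.count-next 2≤n CD k<n agree differ j<n)
  ...   | inj₁ 3+m<j = δ-unchanged (count 2≤n C (y j j<n)) (count 2≤n D (y j j<n))
    (δ-≢ j≢k) (δ-≢ (>⇒≢ 3+m<j))
    (Departure.count-after 2≤n CD k<n agree differ (≤-<-trans k<j j<n) (≤-<-trans 3+m<j j<n) j<n 3+m<j)

-- Flows with given values on the nonslack edges

module _ {p : ℕ} where

  private
    n = 3 + p

    2≤n : 2 ≤ n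
    2≤n = s≤s (s≤s z≤n)

  module _ {Y : ℕ → ℕ} (valid : Valid n Y) where
    open Valid valid

    private
      v = flowValue {n} Y

    conserved-inner : ∀ m (k<n : 2 + m < n) →
      + Σ-into v (2 + m) ℤ.+ netflow n (2 + m) ≡ + Σ-outOf v (2 + m)
    conserved-inner m k<n rewrite ≢⇒≡ᵇ (<⇒≢ k<n) = begin
      + Σ-into v (2 + m) ℤ.+ 1ℤ           ≡⟨ cong (λ z → + z ℤ.+ 1ℤ) into ⟩
      -- Adding `Y (1 + m)` to both sides completes the truncated differences in `v x₁` and `v x₂`
      -- to `m` and `1 + m`.
      + (v x₁ + (Y m + 0)) ℤ.+ 1ℤ         ≡⟨ cong +_ (+-cancelʳ-≡ (Y (1 + m)) _ _ balance) ⟩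
      + (v x₂ + (Y (2 + m) + 0))          ≡⟨ cong +_ (sym out) ⟩
      + Σ-outOf v (2 + m)                 ∎
      where
      open ≡-Reasoning
      1+m<n = <-trans (n<1+n _) k<n
      x₁ x₂ y₁ y₂ : Edge n
      x₁ = x (1 + m) (s≤s z≤n) 1+m<n
      x₂ = x (2 + m) (s≤s z≤n) k<n
      y₁ = y m (<-trans (n<1+n _) 1+m<n)
      y₂ = y (2 + m) k<n
      into : Σ-into v (2 + m) ≡ v x₁ + (Y m + 0)
      into = sum-filter (λ e → target e ≟ 2 + m) v (x₁ ∷ y₁ ∷ []) (((λ ()) ∷ []) ∷ [] ∷ []) complete
        (λ { (here refl) → refl ; (there (here refl)) → m≤n⇒m⊓n≡m (<⇒≤ k<n) })
        where
        complete : ∀ {e} → target e ≡ 2 + m → e ∈ x₁ ∷ y₁ ∷ []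
        complete {x _ _ _} refl = here refl
        complete {y i q} eq with target-y q k<n eq
        ... | refl = there (here refl)
      out : Σ-outOf v (2 + m) ≡ v x₂ + (Y (2 + m) + 0)
      out = sum-filter (λ e → source e ≟ 2 + m) v (x₂ ∷ y₂ ∷ []) (((λ ()) ∷ []) ∷ [] ∷ []) complete
        (λ { (here refl) → refl ; (there (here refl)) → refl })
        where
        complete : ∀ {e} → source e ≡ 2 + m → e ∈ x₂ ∷ y₂ ∷ []
        complete {x _ _ _}     refl = here refl
        complete {y (suc i) _} refl = there (here refl)
      balance : v x₁ + (Y m + 0) + 1 + Y (1 + m) ≡ v x₂ + (Y (2 + m) + 0) + Y (1 + m)
      balance = begin
        v x₁ + (Y m + 0) + 1 + Y (1 + m)       ≡⟨ arrange₁ (v x₁) (Y m) (Y (1 + m)) ⟩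
        suc (v x₁ + (Y m + Y (1 + m)))         ≡⟨ cong suc (m∸n+n≡m (bound m 1+m<n)) ⟩
        suc m                                  ≡⟨ sym (m∸n+n≡m (bound (1 + m) k<n)) ⟩
        v x₂ + (Y (1 + m) + Y (2 + m))         ≡⟨ arrange₂ (v x₂) (Y (1 + m)) (Y (2 + m)) ⟩
        v x₂ + (Y (2 + m) + 0) + Y (1 + m)     ∎
        where
        arrange₁ : ∀ a b c → a + (b + 0) + 1 + c ≡ suc (a + (b + c))
        arrange₁ = ℕ.solve-∀
        arrange₂ : ∀ a b c → a + (b + c) ≡ a + (c + 0) + b
        arrange₂ = ℕ.solve-∀

    conserved-first : + Σ-into v 1 ℤ.+ netflow n 1 ≡ + Σ-outOf v 1
    conserved-first = trans (cong (λ z → + z ℤ.+ 0ℤ) into) (cong +_ (sym (trans out zeros)))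
      where
      x₁ y₀ y₁ : Edge n
      x₁ = x 1 (s≤s z≤n) (s≤s (s≤s z≤n))
      y₀ = y 0 z<s
      y₁ = y 1 (s≤s (s≤s z≤n))
      into : Σ-into v 1 ≡ 0
      into = sum-filter (λ e → target e ≟ 1) v [] [] complete (λ ())
        where
        complete : ∀ {e : Edge n} → target e ≡ 1 → e ∈ []
        complete {x zero 1≤0 _} _ with () ← recompute (1 ≤? 0) 1≤0
      out : Σ-outOf v 1 ≡ v x₁ + (Y 0 + (Y 1 + 0))
      out = sum-filter (λ e → source e ≟ 1) v (x₁ ∷ y₀ ∷ y₁ ∷ [])
        (((λ ()) ∷ (λ ()) ∷ []) ∷ ((λ ()) ∷ []) ∷ [] ∷ []) complete
        (λ { (here refl) → refl ; (there (here refl)) → refl ; (there (there (here refl))) → refl })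
        where
        complete : ∀ {e : Edge n} → source e ≡ 1 → e ∈ x₁ ∷ y₀ ∷ y₁ ∷ []
        complete {x _ _ _} refl = here refl
        complete {y 0 _}   _    = there (here refl)
        complete {y 1 _}   _    = there (there (here refl))
      zeros : v x₁ + (Y 0 + (Y 1 + 0)) ≡ 0
      zeros rewrite at-0 | at-1 = refl

    conserved-last : + Σ-into v n ℤ.+ netflow n n ≡ + Σ-outOf v n
    conserved-last = begin
      + Σ-into v n ℤ.+ netflow n n        ≡⟨ cong₂ (λ a b → + a ℤ.+ b) (trans into total) net ⟩
      + (1 + p) ℤ.+ ℤ.- + (1 + p)         ≡⟨ ℤ.+-inverseʳ (+ (1 + p)) ⟩
      0ℤ                                  ≡⟨ cong +_ (sym out) ⟩
      + Σ-outOf v n                       ∎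
      where
      open ≡-Reasoning
      x₁ y₁ y₂ : Edge n
      x₁ = x (2 + p) (s≤s z≤n) ≤-refl
      y₁ = y (1 + p) (n≤1+n _)
      y₂ = y (2 + p) ≤-refl
      net : netflow n n ≡ ℤ.- + (1 + p)
      net rewrite ≡ᵇ-refl p = refl
      out : Σ-outOf v n ≡ 0
      out = sum-filter (λ e → source e ≟ n) v [] [] complete (λ ())
        where
        complete : ∀ {e : Edge n} → source e ≡ n → e ∈ []
        complete {x _ _ i<n}     refl = contradiction (recompute (_ <? _) i<n) (<-irrefl refl)
        complete {y (suc _) i<n} refl = contradiction (recompute (_ <? _) i<n) (<-irrefl refl)
      into : Σ-into v n ≡ v x₁ + (Y (1 + p) + (Y (2 + p) + 0))
      into = sum-filter (λ e → target e ≟ n) v (x₁ ∷ y₁ ∷ y₂ ∷ [])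
        (((λ ()) ∷ (λ ()) ∷ []) ∷ ((λ ()) ∷ []) ∷ [] ∷ []) complete
        (λ { (here refl) → refl
           ; (there (here refl)) → m≤n⇒m⊓n≡m ≤-refl
           ; (there (there (here refl))) → m≥n⇒m⊓n≡n (n≤1+n n) })
        where
        complete : ∀ {e : Edge n} → target e ≡ n → e ∈ x₁ ∷ y₁ ∷ y₂ ∷ []
        complete {x _ _ _} refl = here refl
        complete {y i i<n} eq with m≤n⇒m<n∨m≡n (recompute (i <? n) i<n)
        ... | inj₂ refl  = there (there (here refl))
        ... | inj₁ 2+i≤n with trans (sym (m≤n⇒m⊓n≡m 2+i≤n)) eq
        ...   | refl = there (here refl)
      total : v x₁ + (Y (1 + p) + (Y (2 + p) + 0)) ≡ 1 + p
      total rewrite +-identityʳ (Y (2 + p)) = m∸n+n≡m (bound (1 + p) ≤-refl)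

    flowOf : Flow n
    flowOf = record { value = v ; conserved = conserved }
      where
      conserved : ∀ i → 1 ≤ i → i ≤ n → + Σ-into v i ℤ.+ netflow n i ≡ + Σ-outOf v i
      conserved 1             _ _   = conserved-first
      conserved (suc (suc m)) _ k≤n with m≤n⇒m<n∨m≡n k≤n
      ... | inj₁ k<n  = conserved-inner m k<n
      ... | inj₂ refl = conserved-last

  inner-< : (k : Fin (n ∸ 2)) → 2 + toℕ k < n
  inner-< k = s<s (s<s (toℕ<n k))

  -- Each move adds its signed unit to a single coordinate. As the coordinates depend only on the
  -- flows, `v` does not depend on the sequence between them.
  coordinate-moves : ∀ {f g : Flow n} {v} → f ⟶⟨ v ⟩ g → ∀ k →
    coordinate (+_ ∘ value g) (2 + toℕ k) ≡ coordinate (+_ ∘ value f) (2 + toℕ k) ℤ.+ lookup v k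
  coordinate-moves {f} [] k rewrite lookup-replicate k 0ℤ = sym (ℤ.+-identityʳ (coordinate (+_ ∘ value f) (2 + toℕ k)))
  coordinate-moves {f} {h} (_∷_ {g = g} {s = s} {k = i} {v = v} m ms) k = begin
    F h                                     ≡⟨ coordinate-moves ms k ⟩
    F g ℤ.+ lookup v k                      ≡⟨ cong (ℤ._+ lookup v k) (coordinate-move (inner-< k) m) ⟩
    F f ℤ.+ (s ◃ 1) ℤ.* δ (2 + toℕ k) (2 + toℕ i) ℤ.+ lookup v k
      ≡⟨ ℤ.+-assoc (F f) _ (lookup v k) ⟩
    F f ℤ.+ ((s ◃ 1) ℤ.* δ (toℕ k) (toℕ i) ℤ.+ lookup v k)
      ≡⟨ cong (λ z → F f ℤ.+ (z ℤ.+ lookup v k)) (sym (lookup-±e s i k)) ⟩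
    F f ℤ.+ (lookup (±e s i) k ℤ.+ lookup v k)
      ≡⟨ cong (λ z → F f ℤ.+ z) (sym (lookup-zipWith ℤ._+_ k (±e s i) v)) ⟩
    F f ℤ.+ lookup (±e s i ⊞ v) k           ∎
    where
    open ≡-Reasoning
    F : Flow n → ℤ
    F f = coordinate (+_ ∘ value f) (2 + toℕ k)

  -- Undoing moves yields a sequence from its end, whereas `_∷_` extends it at the front.
  ⟶-snoc : ∀ {f g h : Flow n} {v s i} → 2 ≤ i → i < n → f ⟶⟨ v ⟩ g → Move i g h s → ∃[ w ] f ⟶⟨ w ⟩ h
  ⟶-snoc {i = 1} (s≤s ()) _ [] _
  ⟶-snoc {g = g} {h} {s = s} {suc (suc i)} (s≤s (s≤s _)) (s≤s (s≤s i<)) [] m =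
    _ , subst (λ i → Move (2 + i) g h s) (sym (toℕ-fromℕ< i<)) m ∷ []
  ⟶-snoc 2≤i i<n (m′ ∷ ms) m with ⟶-snoc 2≤i i<n ms m
  ... | _ , ms′ = _ , m′ ∷ ms′

  -- Slack values are affine in the nonslack ones, so the change on the nonslack edges determines
  -- the change on the slack edges.
  slack-change : ∀ {Y Y′ i} (valid : Valid n Y) (valid′ : Valid n Y′) →
    (∀ {j} → j < n → + Y j ≡ + Y′ j ℤ.+ (δ j i ℤ.- δ j (suc i))) →
    ∀ (e : Edge n) → + flowValue Y e ≡ + flowValue Y′ e ℤ.+ change i e
  slack-change valid valid′ eq (y j j<n) = eq (recompute (j <? n) j<n)
  slack-change valid valid′ eq (x zero 1≤0 _) with () ← recompute (1 ≤? 0) 1≤0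
  slack-change {Y} {Y′} {i} valid valid′ eq (x (suc j) p q) = begin
    + flowValue {n} Y (x (suc j) p q)
      ≡⟨ flow-value valid ⟩
    + j ℤ.- (+ Y j ℤ.+ + Y (suc j))
      ≡⟨ cong (λ z → + j ℤ.- z) (cong₂ ℤ._+_ (eq (<-trans (n<1+n j) j<n)) (eq j<n)) ⟩
    + j ℤ.- ((+ Y′ j ℤ.+ (δ j i ℤ.- δ j (suc i))) ℤ.+ (+ Y′ (suc j) ℤ.+ (δ (suc j) i ℤ.- δ (suc j) (suc i))))
      -- `δ (suc j) (suc i)` computes to `δ j i`, which cancels.
      ≡⟨ ring (+ j) (+ Y′ j) (δ j i) (δ j (suc i)) (+ Y′ (suc j)) (δ (suc j) i) ⟩
    + j ℤ.- (+ Y′ j ℤ.+ + Y′ (suc j)) ℤ.+ (δ j (suc i) ℤ.- δ (suc j) i)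
      ≡⟨ cong (ℤ._+ (δ j (suc i) ℤ.- δ (suc j) i)) (sym (flow-value valid′)) ⟩
    + flowValue {n} Y′ (x (suc j) p q) ℤ.+ change i (x {n} (suc j) p q) ∎
    where
    open ≡-Reasoning
    j<n : suc j < n
    j<n = recompute (suc j <? n) q
    flow-value : ∀ {Y} → Valid n Y → + flowValue {n} Y (x (suc j) p q) ≡ + j ℤ.- (+ Y j ℤ.+ + Y (suc j))
    flow-value {Y} valid = trans (sym (ℤ.⊖-≥ (Valid.bound valid j j<n))) (sym (ℤ.m-n≡m⊖n j (Y j + Y (suc j))))
    ring : ∀ a b c d e f → a ℤ.- ((b ℤ.+ (c ℤ.- d)) ℤ.+ (e ℤ.+ (f ℤ.- c))) ≡ a ℤ.- (b ℤ.+ e) ℤ.+ (d ℤ.- f)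
    ring = ℤ.solve-∀

  -- Reachability from the initial flow

  -- The move m⁻ᵢ applies at the last i with Y i > 0, and results in Y′.
  module Undo {Y : ℕ → ℕ} (valid : Valid n Y) {i} (2≤i : 2 ≤ i) (i<n : i < n) (0<Yi : 0 < Y i)
              (last : ∀ j → i < j → j < n → Y j ≡ 0) where
    open Valid valid

    -- For `i = n - 1` the unit taken from index `i` lands at index `n`, which belongs to no edge.
    Y′ : ℕ → ℕ
    Y′ j = (Y j ∸ ι j i) + ι j (suc i)

    Y′-balance : ∀ j → Y′ j + ι j i ≡ Y j + ι j (suc i)
    Y′-balance j = begin
      Y j ∸ ι j i + ι j (suc i) + ι j i   ≡⟨ swap (Y j ∸ ι j i) (ι j (suc i)) (ι j i) ⟩
      Y j ∸ ι j i + ι j i + ι j (suc i)   ≡⟨ cong (_+ ι j (suc i)) (m∸n+n≡m (ι≤Y j)) ⟩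
      Y j + ι j (suc i)                   ∎
      where
      open ≡-Reasoning
      swap : ∀ a b c → a + b + c ≡ a + c + b
      swap = ℕ.solve-∀
      ι≤Y : ∀ j → ι j i ≤ Y j
      ι≤Y j with j ≟ i
      ... | yes refl rewrite ι-refl j = 0<Yi
      ... | no j≢i rewrite ι-≢ j≢i = z≤n

    Y′-pair : ∀ j → Y′ j + Y′ (suc j) + ι (suc j) i ≡ Y j + Y (suc j) + ι j (suc i)
    Y′-pair j = +-cancelʳ-≡ (ι j i) _ _ (begin
      Y′ j + Y′ (suc j) + ι (suc j) i + ι j i       ≡⟨ arrange (Y′ j) (Y′ (suc j)) (ι (suc j) i) (ι j i) ⟩
      (Y′ j + ι j i) + (Y′ (suc j) + ι (suc j) i)   ≡⟨ cong₂ _+_ (Y′-balance j) (Y′-balance (suc j)) ⟩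
      (Y j + ι j (suc i)) + (Y (suc j) + ι j i)     ≡⟨ arrange′ (Y j) (ι j (suc i)) (Y (suc j)) (ι j i) ⟩
      Y j + Y (suc j) + ι j (suc i) + ι j i         ∎)
      where
      open ≡-Reasoning
      arrange : ∀ a b c d → a + b + c + d ≡ (a + d) + (b + c)
      arrange = ℕ.solve-∀
      arrange′ : ∀ a b c d → (a + b) + (c + d) ≡ a + c + b + d
      arrange′ = ℕ.solve-∀

    valid′ : Valid n Y′
    valid′ = record { at-0 = zero-at 0 (λ { refl → n≮0 (≤-trans (n≤1+n 1) 2≤i) }) (λ ()) at-0
                    ; at-1 = zero-at 1 (λ { refl → 1+n≰n 2≤i }) (λ { refl → n≮0 2≤i }) at-1
                    ; bound = bound′ }
      where
      zero-at : ∀ j → j ≢ i → j ≢ suc i → Y j ≡ 0 → Y′ j ≡ 0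
      zero-at j j≢i j≢1+i Yj≡0 rewrite ι-≢ j≢i | ι-≢ j≢1+i | Yj≡0 = refl
      bound′ : ∀ j → suc j < n → Y′ j + Y′ (suc j) ≤ j
      bound′ j j<n = ≤-trans (m≤m+n _ (ι (suc j) i)) (≤-trans (≤-reflexive (Y′-pair j)) right)
        where
        right : Y j + Y (suc j) + ι j (suc i) ≤ j
        right with j ≟ suc i
        ... | no j≢1+i rewrite ι-≢ j≢1+i | +-identityʳ (Y j + Y (suc j)) = bound j j<n
        -- Only the pair `suc i`, `2 + i` gains a unit, and both of its old values vanish because
        -- `i` is the last positive index.
        ... | yes refl
          rewrite ι-refl i | last (suc i) ≤-refl (<-trans (n<1+n _) j<n) | last (2 + i) (n≤1+n _) j<n = s≤s z≤n

    change-eq : ∀ j → + Y j ≡ + Y′ j ℤ.+ (δ j i ℤ.- δ j (suc i))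
    change-eq j = trans (cancel (+ Y j) (δ j (suc i)))
      (trans (cong (ℤ._- δ j (suc i)) balance) (ℤ.+-assoc (+ Y′ j) (δ j i) _))
      where
      cancel : ∀ a b → a ≡ a ℤ.+ b ℤ.- b
      cancel = ℤ.solve-∀
      balance : + Y j ℤ.+ δ j (suc i) ≡ + Y′ j ℤ.+ δ j i
      balance rewrite sym (+ι≡δ j (suc i)) | sym (+ι≡δ j i) = cong +_ (sym (Y′-balance j))

    move : Move i (flowOf valid′) (flowOf valid) Sign.+
    move = m⁺ x-positive (λ _ → y-positive) (slack-change valid valid′ λ {j} _ → change-eq j)
      where
      y-positive : 0 < Y′ (suc i)
      y-positive rewrite ι-refl i = m≤n+m 1 _
      x-positive : ∀ .q .r → 0 < flowValue {n} Y′ (x i q r)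
      x-positive q r = positive 2≤i i<n Y′-pair bound
        where
        -- The pair `i - 1`, `i` loses a unit, which makes the bound at `x i` strict. The facts are
        -- restated for a fresh `i`, so that it can be matched as a successor.
        positive : ∀ {i} → 2 ≤ i → i < n → (∀ j → Y′ j + Y′ (suc j) + ι (suc j) i ≡ Y j + Y (suc j) + ι j (suc i)) →
                   (∀ j → suc j < n → Y j + Y (suc j) ≤ j) → ∀ .{q r} → 0 < flowValue {n} Y′ (x i q r)
        positive {suc j} 2≤i i<n pair bound = m<n⇒0<n∸m (begin
          suc (Y′ j + Y′ (suc j))             ≡⟨ +-comm 1 _ ⟩
          Y′ j + Y′ (suc j) + 1               ≡⟨ cong (λ z → Y′ j + Y′ (suc j) + z) (sym (ι-refl j)) ⟩
          Y′ j + Y′ (suc j) + ι j j           ≡⟨ pair j ⟩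
          Y j + Y (suc j) + ι j (2 + j)       ≡⟨ cong (λ z → Y j + Y (suc j) + z) (ι-≢ (<⇒≢ (m≤n+m (suc j) 1))) ⟩
          Y j + Y (suc j) + 0                 ≡⟨ +-identityʳ _ ⟩
          Y j + Y (suc j)                     ≤⟨ bound j i<n ⟩
          j                                   ∎)
          where open ≤-Reasoning

    sumTo-Y′ : ∀ k → sumTo Y′ k + ι k i ≡ sumTo Y k
    sumTo-Y′ zero    = trans (Y′-balance 0) (+-identityʳ (Y 0))
    sumTo-Y′ (suc k) = begin
      sumTo Y′ k + Y′ (suc k) + ι (suc k) i     ≡⟨ +-assoc (sumTo Y′ k) _ _ ⟩
      sumTo Y′ k + (Y′ (suc k) + ι (suc k) i)   ≡⟨ cong (λ z → sumTo Y′ k + z) (Y′-balance (suc k)) ⟩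
      sumTo Y′ k + (Y (suc k) + ι k i)          ≡⟨ arrange (sumTo Y′ k) (Y (suc k)) (ι k i) ⟩
      (sumTo Y′ k + ι k i) + Y (suc k)          ≡⟨ cong (_+ Y (suc k)) (sumTo-Y′ k) ⟩
      sumTo Y k + Y (suc k)                     ∎
      where
      open ≡-Reasoning
      arrange : ∀ a b c → a + (b + c) ≡ (a + c) + b
      arrange = ℕ.solve-∀

    -- The inner sums are the coordinates, of which only the one at `i` changes, dropping by one.
    decreasing : sumTo (sumTo Y′) n < sumTo (sumTo Y) n
    decreasing = sumTo-mono-< n (<⇒≤ i<n) (λ j _ → subst (sumTo Y′ j ≤_) (sumTo-Y′ j) (m≤m+n _ (ι j i)))
      (subst (sumTo Y′ i <_) (sumTo-Y′ i) (m<m+n _ (≤-reflexive (sym (ι-refl i)))))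

  last-positive : ∀ (Y : ℕ → ℕ) m → (∀ j → j < m → Y j ≡ 0) ⊎
                  (∃[ i ] i < m × 0 < Y i × (∀ j → i < j → j < m → Y j ≡ 0))
  last-positive Y zero = inj₁ λ _ ()
  last-positive Y (suc m) with Y m in eq
  ... | suc _ = inj₂ (m , ≤-refl , subst (0 <_) (sym eq) z<s ,
    λ j m<j j<1+m → contradiction m<j (≤⇒≯ (s≤s⁻¹ j<1+m)))
  ... | zero with last-positive Y m
  ...   | inj₁ zeros = inj₁ λ j j<1+m → [ zeros j , (λ { refl → eq }) ]′ (m≤n⇒m<n∨m≡n (s≤s⁻¹ j<1+m))
  ...   | inj₂ (i , i<m , 0<Yi , zeros) = inj₂ (i , m≤n⇒m≤1+n i<m , 0<Yi , λ j i<j j<1+m →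
            [ zeros j i<j , (λ { refl → eq }) ]′ (m≤n⇒m<n∨m≡n (s≤s⁻¹ j<1+m)))

  Initial : Flow n → Set
  Initial f = ∀ e → value f e ≡ φ₀ e

  reachable : ∀ {Y} (valid : Valid n Y) → Σ[ f ∈ Flow n ] Initial f × (∃[ v ] f ⟶⟨ v ⟩ flowOf valid)
  reachable valid = go valid (<-wellFounded _)
    where
    go : ∀ {Y} (valid : Valid n Y) → Acc _<_ (sumTo (sumTo Y) n) →
         Σ[ f ∈ Flow n ] Initial f × (∃[ v ] f ⟶⟨ v ⟩ flowOf valid)
    go {Y} valid (acc rs) with last-positive Y n
    ... | inj₁ zeros = flowOf valid , initial , _ , []
      where
      initial : Initial (flowOf valid)
      initial (x zero _ _)    = refl
      initial (x (suc i) _ q)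
        rewrite zeros i (<-trans (n<1+n i) (recompute (suc i <? n) q))
              | zeros (suc i) (recompute (suc i <? n) q) = refl
      initial (y i q)         = zeros i (recompute (i <? n) q)
    ... | inj₂ (0 , _ , 0<Y , _) = contradiction (subst (0 <_) (Valid.at-0 valid) 0<Y) n≮0
    ... | inj₂ (1 , _ , 0<Y , _) = contradiction (subst (0 <_) (Valid.at-1 valid) 0<Y) n≮0
    ... | inj₂ (suc (suc i) , i<n , 0<Yi , zeros) =
      let open Undo valid {2 + i} (s≤s (s≤s z≤n)) i<n 0<Yi zeros
          f , f₀ , _ , ms = go valid′ (rs decreasing)
      in f , f₀ , ⟶-snoc (s≤s (s≤s z≤n)) i<n ms move

  -- The coordinate vector

  -- Edges leaving vertex 1 have count 1, so the value 0 that `φ` prescribes there fits the general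
  -- formula.
  φ-count : ∀ (C : MaximalClique n) e → φ C e ≡ + count 2≤n C e ℤ.- 1ℤ
  φ-count C e = if-1 (source e ≡ᵇ 1) (count 2≤n C e) (λ s≡1 → count-first 2≤n C e (≡ᵇ⇒≡ (source e) 1 s≡1))
    where
    if-1 : ∀ b c → (T b → c ≡ 1) → (if b then 0ℤ else + c ℤ.- 1ℤ) ≡ + c ℤ.- 1ℤ
    if-1 false c _ = refl
    if-1 true  c c≡1 rewrite c≡1 tt = refl

  excess : MaximalClique n → ℕ → ℕ
  excess C j with j <? n
  ... | yes j<n = count 2≤n C (y j j<n) ∸ 1
  ... | no  _   = 0

  excess-< : ∀ C {j} (j<n : j < n) → suc (excess C j) ≡ count 2≤n C (y j j<n)
  excess-< C {j} j<n with j <? n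
  ... | yes _  = m+[n∸m]≡n (count-y 2≤n C j j<n)
  ... | no j≮n = contradiction j<n j≮n

  excess-0 : ∀ C → excess C 0 ≡ 0
  excess-0 C = suc-injective (trans (excess-< C z<s) (count-first 2≤n C (y 0 z<s) refl))

  excess-1 : ∀ C → excess C 1 ≡ 0
  excess-1 C = suc-injective (trans (excess-< C 1<n) (count-first 2≤n C (y 1 1<n) refl))
    where
    1<n : 1 < n
    1<n = s≤s (s≤s z≤n)

  -- The relation between slack and nonslack values propagates from vertex 1 by `count-conserved`.
  -- It reads `suc i` rather than `i` because a count exceeds the flow value by one.
  slack-count : ∀ C i (i<n : suc i < n) →
    count 2≤n C (x (suc i) (s≤s z≤n) i<n) + (excess C i + excess C (suc i)) ≡ suc i
  slack-count C zero i<n = cong₂ _+_ (count-first 2≤n C (x 1 (s≤s z≤n) i<n) refl) (cong₂ _+_ (excess-0 C) (excess-1 C))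
  slack-count C (suc i) k<n = step
    (trans (cong (λ c → count 2≤n C (x (2 + i) (s≤s z≤n) k<n) + c) (excess-< C k<n))
      (trans (count-conserved 2≤n C i k<n)
        (cong (λ c → suc (count 2≤n C (x (1 + i) (s≤s z≤n) i<n) + c)) (sym (excess-< C (<-trans (n<1+n _) i<n))))))
    (slack-count C i i<n)
    where
    i<n = <-trans (n<1+n _) k<n
    step : ∀ {a₁ a₂ e₀ e₁ e₂ i} →
           a₂ + suc e₂ ≡ suc (a₁ + suc e₀) → a₁ + (e₀ + e₁) ≡ suc i → a₂ + (e₁ + e₂) ≡ 2 + i
    step {a₁} {a₂} {e₀} {e₁} {e₂} {i} eq₂ eq₁ = suc-injective (begin
      suc (a₂ + (e₁ + e₂))         ≡⟨ arrange a₂ e₁ e₂ ⟩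
      (a₂ + suc e₂) + e₁           ≡⟨ cong (_+ e₁) eq₂ ⟩
      suc (a₁ + suc e₀) + e₁       ≡⟨ arrange′ a₁ e₀ e₁ ⟩
      2 + (a₁ + (e₀ + e₁))         ≡⟨ cong (λ z → 2 + z) eq₁ ⟩
      3 + i                        ∎)
      where
      open ≡-Reasoning
      arrange : ∀ a b c → suc (a + (b + c)) ≡ (a + suc c) + b
      arrange = ℕ.solve-∀
      arrange′ : ∀ a b c → suc (a + suc b) + c ≡ 2 + (a + (b + c))
      arrange′ = ℕ.solve-∀

  slack-excess : ∀ C i (i<n : suc i < n) →
    count 2≤n C (x (suc i) (s≤s z≤n) i<n) ∸ 1 + (excess C i + excess C (suc i)) ≡ i
  slack-excess C i i<n = drop (positive i i<n) (slack-count C i i<n)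
    where
    positive : ∀ i (i<n : suc i < n) → 1 ≤ count 2≤n C (x (suc i) (s≤s z≤n) i<n)
    positive zero    i<n = ≤-reflexive (sym (count-first 2≤n C (x 1 (s≤s z≤n) i<n) refl))
    positive (suc i) i<n = count-x 2≤n C (2 + i) (s≤s (s≤s z≤n)) i<n
    drop : ∀ {c s i} → 1 ≤ c → c + s ≡ suc i → c ∸ 1 + s ≡ i
    drop {suc _} _ eq = suc-injective eq

  excess-valid : ∀ C → Valid n (excess C)
  excess-valid C = record
    { at-0  = excess-0 C
    ; at-1  = excess-1 C
    ; bound = λ i i<n → subst (excess C i + excess C (suc i) ≤_) (slack-excess C i i<n)
        (m≤n+m (excess C i + excess C (suc i)) (count 2≤n C (x (suc i) (s≤s z≤n) i<n) ∸ 1))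
    }

  flowOf-φ : ∀ C e → + flowValue {n} (excess C) e ≡ φ C e
  flowOf-φ C e = trans (value-count e) (sym (φ-count C e))
    where
    value-count : ∀ e → + flowValue {n} (excess C) e ≡ + count 2≤n C e ℤ.- 1ℤ
    value-count (x zero 1≤0 _) with () ← recompute (1 ≤? 0) 1≤0
    value-count (y i q) = cong (λ c → + c ℤ.- 1ℤ) (excess-< C (recompute (i <? n) q))
    value-count (x (suc i) r q) = shape (count 2≤n C (x (suc i) r q)) (excess C i + excess C (suc i)) i
      (slack-excess C i i<n) (slack-count C i i<n)
      where
      i<n = recompute (suc i <? n) q
      shape : ∀ c s i → c ∸ 1 + s ≡ i → c + s ≡ suc i → + (i ∸ s) ≡ + c ℤ.- 1ℤ
      shape zero    s _ refl eq = contradiction eq (<⇒≢ ≤-refl)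
      shape (suc c) s _ refl _  = cong +_ (m+n∸n≡m c s)

  𝐱 : MaximalClique n → Vec ℤ (n ∸ 2)
  𝐱 C = tabulate λ k → coordinate (φ C) (2 + toℕ k)

  tabulate-lookup : ∀ {d} {f : Fin d → ℤ} {v} → (∀ k → f k ≡ lookup v k) → tabulate f ≡ v
  tabulate-lookup {v = v} eq = trans (tabulate-cong eq) (tabulate∘lookup v)

  coordinates-unique : ∀ C v → IsCoordinateVector C v → 𝐱 C ≡ v
  coordinates-unique C v (f , g , f₀ , ms , gφ) = tabulate-lookup λ k → begin
    coordinate (φ C) (2 + toℕ k)               ≡⟨ coordinate-cong (sym ∘ gφ) k ⟩
    coordinate (+_ ∘ value g) (2 + toℕ k)      ≡⟨ coordinate-moves ms k ⟩
    coordinate (+_ ∘ value f) (2 + toℕ k) ℤ.+ lookup v k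
      -- `φ₀` vanishes on the nonslack edges, so every coordinate starts at 0.
      ≡⟨ cong (ℤ._+ lookup v k) (partialSum-0 (2 + toℕ k) λ j j≤k →
           let j<n = ≤-<-trans j≤k (inner-< k) in
           trans (nonslackValues-< (+_ ∘ value f) j<n) (cong +_ (f₀ (y j j<n)))) ⟩
    0ℤ ℤ.+ lookup v k                          ≡⟨ ℤ.+-identityˡ (lookup v k) ⟩
    lookup v k                                 ∎
    where
    open ≡-Reasoning
    coordinate-cong : ∀ {g h : Edge n → ℤ} → (∀ e → g e ≡ h e) → ∀ (k : Fin (n ∸ 2)) →
                      coordinate g (2 + toℕ k) ≡ coordinate h (2 + toℕ k)
    coordinate-cong {g} {h} eq k = partialSum-cong (2 + toℕ k) λ j j≤k →
      let j<n = ≤-<-trans j≤k (inner-< k) in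
      trans (nonslackValues-< g j<n) (trans (eq (y j j<n)) (sym (nonslackValues-< h j<n)))

  coordinates-exist : ∀ C → IsCoordinateVector C (𝐱 C)
  coordinates-exist C with reachable (excess-valid C)
  -- The vector of the sequence found is never computed; uniqueness identifies it with `𝐱 C`.
  ... | f , f₀ , v , ms = subst (IsCoordinateVector C) (sym (coordinates-unique C v coords)) coords
    where
    coords : IsCoordinateVector C v
    coords = f , flowOf (excess-valid C) , f₀ , ms , flowOf-φ C

  count-φ-injective : ∀ C D e → φ C e ≡ φ D e → count 2≤n C e ≡ count 2≤n D e
  count-φ-injective C D e eq = cancel (count 2≤n C e) (count 2≤n D e)
    (trans (sym (φ-count C e)) (trans eq (φ-count D e)))
    where
    cancel : ∀ a b → + a ℤ.- 1ℤ ≡ + b ℤ.- 1ℤ → a ≡ b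
    cancel a b eq = ℤ.+-injective (trans (undo (+ a)) (trans (cong (ℤ._+ 1ℤ) eq) (sym (undo (+ b)))))
      where
      undo : ∀ a → a ≡ a ℤ.- 1ℤ ℤ.+ 1ℤ
      undo = ℤ.solve-∀

  -- Coordinates are partial sums, so they return the values on the nonslack edges, hence the
  -- counts, which determine the clique.
  𝐱-injective : ∀ C D → 𝐱 C ≡ 𝐱 D → C ≈ D
  𝐱-injective C D eq = count-injective 2≤n C D λ {j} j<n _ → count-φ-injective C D (y j j<n) (begin
    φ C (y j j<n)            ≡⟨ sym (nonslackValues-< (φ C) j<n) ⟩
    nonslackValues (φ C) j   ≡⟨ partialSum-injective j (λ i i≤j → coordinate-≡ i (≤-<-trans i≤j j<n)) ⟩
    nonslackValues (φ D) j   ≡⟨ nonslackValues-< (φ D) j<n ⟩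
    φ D (y j j<n)            ∎)
    where
    open ≡-Reasoning
    coordinate-≡ : ∀ i → i < n → coordinate (φ C) i ≡ coordinate (φ D) i
    -- `y 0` and `y 1` leave vertex 1, where `φ` is 0 by definition.
    coordinate-≡ 0 _ = refl
    coordinate-≡ 1 _ = refl
    coordinate-≡ (suc (suc i)) (s≤s (s≤s i<)) = begin
      coordinate (φ C) (2 + i)                ≡⟨ cong (λ i → coordinate (φ C) (2 + i)) (sym (toℕ-fromℕ< i<)) ⟩
      coordinate (φ C) (2 + toℕ k)            ≡⟨ sym (lookup∘tabulate (λ k → coordinate (φ C) (2 + toℕ k)) k) ⟩
      lookup (𝐱 C) k                          ≡⟨ cong (λ v → lookup v k) eq ⟩
      lookup (𝐱 D) k                          ≡⟨ lookup∘tabulate (λ k → coordinate (φ D) (2 + toℕ k)) k ⟩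
      coordinate (φ D) (2 + toℕ k)            ≡⟨ cong (λ i → coordinate (φ D) (2 + i)) (toℕ-fromℕ< i<) ⟩
      coordinate (φ D) (2 + i)                ∎
      where
      k = fromℕ< i<

  -- Coordinates of adjacent cliques

  step-coordinate : ∀ {C D R S} → Exchanged C D R S → ∀ {m} (k<n : 2 + m < n) → AgreeBelow 2≤n C D (2 + m) →
    count 2≤n D (y (2 + m) k<n) < count 2≤n C (y (2 + m) k<n) →
    Σ[ k ∈ Fin (n ∸ 2) ] (∀ (i : Fin (n ∸ 2)) →
      coordinate (φ C) (2 + toℕ i) ≡ coordinate (φ D) (2 + toℕ i) ℤ.+ δ (toℕ i) (toℕ k))
  step-coordinate {C} {D} CD {m} k<n@(s≤s (s≤s m<)) agree differ = fromℕ< m< , λ i →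
    subst (λ m → coordinate (φ C) (2 + toℕ i) ≡ coordinate (φ D) (2 + toℕ i) ℤ.+ δ (toℕ i) m) (sym (toℕ-fromℕ< m<))
      (coordinate-change {f = φ D} {φ C} {2 + m} (inner-< i) λ {j} j<n → change-φ j j<n)
    where
    decrement : ∀ (a b : ℕ) {c} → + a ≡ + b ℤ.+ c → + a ℤ.- 1ℤ ≡ + b ℤ.- 1ℤ ℤ.+ c
    decrement a b {c} eq = trans (cong (ℤ._- 1ℤ) eq) (swap (+ b) c)
      where
      swap : ∀ b c → b ℤ.+ c ℤ.- 1ℤ ≡ b ℤ.- 1ℤ ℤ.+ c
      swap = ℤ.solve-∀
    change-φ : ∀ j (j<n : j < n) → φ C (y j j<n) ≡ φ D (y j j<n) ℤ.+ change (2 + m) (y {n} j j<n)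
    change-φ j j<n = trans (φ-count C (y j j<n)) (trans
      (decrement (count 2≤n C (y j j<n)) (count 2≤n D (y j j<n)) (count-change 2≤n CD k<n agree differ j<n))
      (cong (ℤ._+ change (2 + m) (y {n} j j<n)) (sym (φ-count D (y j j<n)))))

  Difference : (C D : MaximalClique n) → Set
  Difference C D = Σ[ j ∈ ℕ ] Σ[ j<n ∈ j < n ] AgreeBelow 2≤n C D j × count 2≤n C (y j j<n) ≢ count 2≤n D (y j j<n)

  first-difference : ∀ C D i → AgreeBelow 2≤n C D i ⊎ Difference C D
  first-difference C D zero = inj₁ λ _ ()
  first-difference C D (suc i) with first-difference C D i
  ... | inj₂ found = inj₂ found
  ... | inj₁ agree with i <? n
  ...   | no i≮n = inj₁ λ j<n j≤i → agree j<n (<-≤-trans j<n (≮⇒≥ i≮n))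
  ...   | yes i<n = decide (count 2≤n C (y i i<n) ≟ count 2≤n D (y i i<n))
    where
    decide : Dec (count 2≤n C (y i i<n) ≡ count 2≤n D (y i i<n)) → AgreeBelow 2≤n C D (suc i) ⊎ Difference C D
    decide (no differ) = inj₂ (i , i<n , agree , differ)
    decide (yes eq)    = inj₁ λ {j} j<n j≤i → [ agree j<n , (λ { refl → eq }) ]′ (m≤n⇒m<n∨m≡n (s≤s⁻¹ j≤i))

  𝐱-step : ∀ C D s k → (∀ (i : Fin (n ∸ 2)) →
             coordinate (φ D) (2 + toℕ i) ≡ coordinate (φ C) (2 + toℕ i) ℤ.+ (s ◃ 1) ℤ.* δ (toℕ i) (toℕ k)) →
           𝐱 D ≡ 𝐱 C ⊞ ±e s k
  𝐱-step C D s k eq = tabulate-lookup λ i → trans (eq i) (sym (trans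
    (lookup-zipWith ℤ._+_ i (𝐱 C) (±e s k))
    (cong₂ ℤ._+_ (lookup∘tabulate (λ k → coordinate (φ C) (2 + toℕ k)) i) (lookup-±e s k i))))

  adjacent-at : ∀ {C D R S} → Exchanged C D R S → ∀ {m} (k<n : 2 + m < n) → AgreeBelow 2≤n C D (2 + m) →
    Tri (count 2≤n C (y (2 + m) k<n) < count 2≤n D (y (2 + m) k<n))
        (count 2≤n C (y (2 + m) k<n) ≡ count 2≤n D (y (2 + m) k<n))
        (count 2≤n D (y (2 + m) k<n) < count 2≤n C (y (2 + m) k<n)) →
    count 2≤n C (y (2 + m) k<n) ≢ count 2≤n D (y (2 + m) k<n) → GridAdjacent (𝐱 C) (𝐱 D)
  adjacent-at CD k<n agree (tri≈ _ eq _) differ = contradiction eq differ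
  -- The clique with the larger count has the larger coordinate; here it is `D`, so the roles are
  -- exchanged and the sign is positive.
  adjacent-at {C} {D} CD k<n agree (tri< lt _ _) _
    with step-coordinate (Exchanged-sym CD) k<n (AgreeBelow-sym 2≤n C D agree) lt
  ... | k , eq = Sign.+ , k , 𝐱-step C D Sign.+ k λ i → trans (eq i)
    (cong (λ z → coordinate (φ C) (2 + toℕ i) ℤ.+ z) (sym (ℤ.*-identityˡ (δ (toℕ i) (toℕ k)))))
  adjacent-at {C} {D} CD k<n agree (tri> _ _ gt) _ with step-coordinate CD k<n agree gt
  ... | k , eq = Sign.- , k , 𝐱-step C D Sign.- k λ i →
    +-reverse (coordinate (φ C) (2 + toℕ i)) (coordinate (φ D) (2 + toℕ i)) (δ (toℕ i) (toℕ k)) (eq i)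

  adjacent-difference : ∀ {C D R S} → Exchanged C D R S → Difference C D → GridAdjacent (𝐱 C) (𝐱 D)
  adjacent-difference {C} {D} CD (0 , j<n , _ , differ) =
    contradiction (trans (count-first 2≤n C (y 0 j<n) refl) (sym (count-first 2≤n D (y 0 j<n) refl))) differ
  adjacent-difference {C} {D} CD (1 , j<n , _ , differ) =
    contradiction (trans (count-first 2≤n C (y 1 j<n) refl) (sym (count-first 2≤n D (y 1 j<n) refl))) differ
  adjacent-difference {C} {D} CD (suc (suc m) , k<n , agree , differ) =
    adjacent-at CD k<n agree (<-cmp (count 2≤n C (y (2 + m) k<n)) (count 2≤n D (y (2 + m) k<n))) differ

  𝐱-adjacent : ∀ C D → Adjacent C D → GridAdjacent (𝐱 C) (𝐱 D)
  𝐱-adjacent C D (R , S , R∈C , R∉D , S∈D , S∉C , same) = conclude (first-difference C D n)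
    where
    conclude : AgreeBelow 2≤n C D n ⊎ Difference C D → GridAdjacent (𝐱 C) (𝐱 D)
    conclude (inj₁ agree) = contradiction (agree⇒⊆ 2≤n C D agree R R∈C) R∉D
    conclude (inj₂ found) = adjacent-difference {C = C} {D} {R} {S} (exchanged R∈C R∉D S∈D S∉C same) found

theorem5 : ∀ n → 3 ≤ n →
    Σ[ 𝐱 ∈ (MaximalClique n → Vec ℤ (n ∸ 2)) ]
    (∀ C v → IsCoordinateVector C v ⇔ 𝐱 C ≡ v) ×
    (∀ C D → 𝐱 C ≡ 𝐱 D → C ≈ D) ×
    (∀ C D → Adjacent C D → GridAdjacent (𝐱 C) (𝐱 D))
theorem5 (suc (suc (suc p))) (s≤s (s≤s (s≤s z≤n))) = 𝐱 {p} ,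
  (λ C v → mk⇔ (coordinates-unique C v) λ { refl → coordinates-exist C }) ,
  𝐱-injective , 𝐱-adjacent
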